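{- For every integer $s>2$, \[ \mathrm{wsat}(2s+1, K_{s,s}) = \binom{2s+1}{2} - (4s-4). \]
   Context: For a fixed graph $F$, an $n$-vertex graph $G$ is called weakly $F$-saturated if $G$ contains no copy of $F$ and there exists an ordering $e_1,\dots,e_m$ of the edges of $E(K_n)\setminus E(G)$ such that for each $i\in\{1,\dots,m\}$ the graph $G\cup\{e_1,\dots,e_i\}$ contains a copy $F_i$ of $F$ with $e_i\in E(F_i)$. The weak saturation number $\mathrm{wsat}(n,F)$ is the minimum number of edges of a weakly $F$-saturated $n$-vertex graph. $K_{s,t}$ denotes the complete bipartite graph with parts of sizes $s$ and $t$. -}

module Defs where

open import Data.Nat using (ℕ; _+_; _<_)
open import Data.Bool using (Bool; true; false; _∨_; _∧_; if_then_else_)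
open import Data.Fin using (Fin; toℕ)
open import Data.Fin.Properties using (_≟_)
open import Data.List using (List; []; _∷_; map; allFin)
open import Data.Nat.ListAction using (sum)
open import Data.List.Membership.Propositional using (_∈_)
open import Data.List.Relation.Unary.Unique.Propositional using (Unique)
open import Data.Product using (Σ; ∃; ∃-syntax; _×_; _,_)
open import Data.Sum using (_⊎_; inj₁; inj₂)
open import Data.Unit using (⊤)
open import Relation.Nullary using (¬_)
open import Relation.Nullary.Decidable using (⌊_⌋)
open import Relation.Binary.PropositionalEquality using (_≡_)
open import Function.Definitions using (Injective)

Graph : ℕ → Set
Graph n = Fin n → Fin n → Bool

IsSimple : ∀ {n} → Graph n → Set
IsSimple {n} G = (∀ (i : Fin n) → G i i ≡ false) × (∀ (i j : Fin n) → G i j ≡ G j i)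

edgeCount : ∀ {n} → Graph n → ℕ
edgeCount {n} G =
  sum (map (λ i → sum (map (λ j → if ⌊ Data.Nat._<?_ (toℕ i) (toℕ j) ⌋ ∧ G i j then 1 else 0)
                            (allFin n)))
           (allFin n))

addEdge : ∀ {n} → Graph n → Fin n → Fin n → Graph n
addEdge G u v i j = G i j ∨ ((⌊ i ≟ u ⌋ ∧ ⌊ j ≟ v ⌋) ∨ (⌊ i ≟ v ⌋ ∧ ⌊ j ≟ u ⌋))

IsCopyKst : ∀ {n} (s t : ℕ) → Graph n → (Fin s ⊎ Fin t → Fin n) → Set
IsCopyKst s t G f =
  Injective _≡_ _≡_ f × (∀ a b → G (f (inj₁ a)) (f (inj₂ b)) ≡ true)

ContainsKst : ∀ {n} (s t : ℕ) → Graph n → Set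
ContainsKst {n} s t G = ∃[ f ] IsCopyKst {n} s t G f

ContainsKstThrough : ∀ {n} (s t : ℕ) → Graph n → Fin n → Fin n → Set
ContainsKstThrough {n} s t G u v =
  ∃[ f ] (IsCopyKst {n} s t G f ×
          ∃[ a ] ∃[ b ] ((f (inj₁ a) ≡ u × f (inj₂ b) ≡ v) ⊎ (f (inj₁ a) ≡ v × f (inj₂ b) ≡ u)))

Edge : ℕ → Set
Edge n = Fin n × Fin n

ValidSequence : ∀ {n} (s t : ℕ) → Graph n → List (Edge n) → Set
ValidSequence s t G [] = ⊤
ValidSequence s t G ((u , v) ∷ es) =
  ContainsKstThrough s t (addEdge G u v) u v × ValidSequence s t (addEdge G u v) es

IsNonEdgeOrdering : ∀ {n} → Graph n → List (Edge n) → Set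
IsNonEdgeOrdering {n} G es =
  Unique es ×
  (∀ (u v : Fin n) → (u , v) ∈ es → (toℕ u < toℕ v × G u v ≡ false)) ×
  (∀ (u v : Fin n) → toℕ u < toℕ v → G u v ≡ false → (u , v) ∈ es)

WeaklySat : ∀ {n} (s t : ℕ) → Graph n → Set
WeaklySat s t G =
  ¬ ContainsKst s t G ×
  ∃[ es ] (IsNonEdgeOrdering G es × ValidSequence s t G es)

WsatIs : (n s t m : ℕ) → Set
WsatIs n s t m =
  (∃[ G ] (IsSimple {n} G × WeaklySat s t G × edgeCount G ≡ m)) ×
  (∀ (G : Graph n) → IsSimple G → WeaklySat s t G → m Data.Nat.≤ edgeCount G)

{-# OPTIONS --safe #-}
module Submission where

-- List the non-edges of G in the order in which they are added. When e is added, the new copy of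
-- K_{s,s} misses one vertex, the centre of a cut, and splits the others into two classes of size s
-- between which e is the only remaining non-edge. Inductively, such a list has at most 2|X| - 3 edges
-- inside any X with |X| ≥ 2, since X falls into two parts sharing at most the centre; this gives
-- 2(2s + 1) - 3 = 4s - 1 edges in all. Balance costs three more, as the first two cuts show.
-- If their centres differ, there are two cases. Either two disjoint sets of size s attain the bound;
-- then every later cut has one of them as a class, so its edge lies in neither, and they are never
-- dismantled. Or the remaining edges lie inside disjoint sets of sizes s and s + 1, and the next cut
-- leads back to the first case. If both cuts have centre v, they leave four cells around v. Each later
-- cut centred at v splits one more cell, and a cut centred elsewhere cannot be balanced without
-- losing too many edges, so the edges at v are never removed.
-- The bound is attained by two disjoint books on s + 1 and s - 1 vertices and one further vertex,
-- linked by two edges. Its complement has no K_{s,s}: otherwise one more edge could be prepended.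

open import Defs
open import Data.Bool using (Bool; true; false; _∧_; _∨_; not; if_then_else_)
open import Data.Bool.Properties using (∨-zeroʳ)
open import Data.Empty using (⊥; ⊥-elim)
open import Data.Fin using (Fin; zero; suc; toℕ; fromℕ<)
open import Data.Fin.Properties using (_≟_; suc-injective; toℕ-fromℕ<)
open import Data.List using (List; []; _∷_; map; allFin; tabulate; length)
open import Data.List.Membership.DecPropositional using () renaming (_∈?_ to member?)
open import Data.List.Membership.Propositional using (_∈_; _∉_)
open import Data.List.Membership.Propositional.Properties using (∈-allFin)
open import Data.List.Properties using (map-tabulate; length-tabulate)
open import Data.List.Relation.Unary.All as All using (All) renaming ([] to []ᴬ; _∷_ to _∷ᴬ_)
open import Data.List.Relation.Unary.All.Properties using (tabulate⁺)
open import Data.List.Relation.Unary.AllPairs using () renaming ([] to []ᴾ; _∷_ to _∷ᴾ_)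
open import Data.List.Relation.Unary.Any using (here; there)
open import Data.List.Relation.Unary.Unique.Propositional using (Unique)
import Data.List.Relation.Unary.Unique.Propositional.Properties as Unique
open import Data.Nat using (ℕ; zero; suc; _+_; _*_; _∸_; _≤_; _<_; z≤n; s≤s; _≤?_)
open import Data.Nat.Combinatorics using (_C_; nCk+nC[k+1]≡[n+1]C[k+1]; nC1≡n)
open import Data.Nat.ListAction using (sum)
open import Data.Nat.Properties
  using ( ≤-refl; ≤-trans; ≤-reflexive; ≤-antisym; ≤-pred; <-irrefl; <-asym; <⇒≢; ≰⇒>; ≮⇒≥; _<?_; n≤1+n; n≤0⇒n≡0
        ; m≤m+n; m≤n+m; +-comm; +-assoc; +-suc; +-identityʳ; +-mono-≤; +-cancelˡ-≡; +-cancelʳ-≤; *-suc; *-monoʳ-≤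
        ; ∸-monoˡ-≤; ∸-monoʳ-≤; m∸n+n≡m; m+n∸n≡m; m+[n∸m]≡n; m+n≤o⇒m≤o∸n; module ≤-Reasoning)
open import Data.Nat.Tactic.RingSolver using (solve)
open import Data.Product using (∃; _×_; _,_; proj₁; proj₂; swap)
open import Data.Product.Properties using (≡-dec)
open import Data.Sum using (_⊎_; inj₁; inj₂; [_,_]′) renaming (map to ⊎-map; swap to ⊎-swap)
open import Data.Sum.Properties using (inj₁-injective; inj₂-injective)
open import Data.Unit using (⊤; tt)
open import Function using (_∘_; id)
open import Function.Definitions using (Injective)
open import Relation.Binary.PropositionalEquality using (_≡_; _≢_; refl; sym; trans; cong; cong₂; subst)
open import Relation.Nullary using (¬_; Dec; yes; no; ¬?)
open import Relation.Nullary.Decidable using (⌊_⌋; _×-dec_; decidable-stable)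

-- c ≤ d as a combination a ≤ b of hypotheses with slack k, up to a semiring identity.
linear : ∀ {a b c d} k → a ≤ b → c + b + k ≡ d + a → c ≤ d
linear {a} {b} {c} {d} k a≤b eq = +-cancelʳ-≤ b c d (begin
  c + b       ≤⟨ m≤m+n (c + b) k ⟩
  c + b + k   ≡⟨ eq ⟩
  d + a       ≤⟨ +-mono-≤ (≤-refl {d}) a≤b ⟩
  d + b       ∎)
  where open ≤-Reasoning

infixl 6 _⊕_
_⊕_ : ∀ {a b c d} → a ≤ b → c ≤ d → a + c ≤ b + d
_⊕_ = +-mono-≤

infixl 7 _⊗_
_⊗_ : ∀ {a b} k → a ≤ b → k * a ≤ k * b
_⊗_ k = *-monoʳ-≤ k

absurd : ∀ {A : Set} → 1 ≤ 0 → A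
absurd ()

-- Zero-one values and sums over lists.

private variable
  S T : Set

bit : Bool → ℕ
bit b = if b then 1 else 0

decide : ∀ b → b ≡ true ⊎ b ≡ false
decide true  = inj₁ refl
decide false = inj₂ refl

conflict : ∀ {b} → b ≡ true → b ≡ false → S
conflict {b = true} _ ()

bit-mono : ∀ {a b} → (a ≡ true → b ≡ true) → bit a ≤ bit b
bit-mono {false} _ = z≤n
bit-mono {true}  f = ≤-reflexive (cong bit (sym (f refl)))

bit-cover : ∀ {a b c} → (a ≡ true → b ≡ true ⊎ c ≡ true) → bit a ≤ bit b + bit c
bit-cover {false} _ = z≤n
bit-cover {true} {b} {c} f with f refl
... | inj₁ refl = s≤s z≤n
... | inj₂ refl = m≤n+m 1 (bit b)

total : List S → (S → ℕ) → ℕ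
total xs f = sum (map f xs)

total-mono : ∀ {f g : S → ℕ} {xs} → All (λ x → f x ≤ g x) xs → total xs f ≤ total xs g
total-mono []ᴬ       = z≤n
total-mono (p ∷ᴬ ps) = p ⊕ total-mono ps

total-cong : ∀ {f g : S → ℕ} xs → (∀ x → f x ≡ g x) → total xs f ≡ total xs g
total-cong []       _ = refl
total-cong (x ∷ xs) p = cong₂ _+_ (p x) (total-cong xs p)

total-+ : ∀ (f g : S → ℕ) xs → total xs (λ x → f x + g x) ≡ total xs f + total xs g
total-+ f g []       = refl
total-+ f g (x ∷ xs) = trans (cong (f x + g x +_) (total-+ f g xs))
  (interchange (f x) (g x) (total xs f) (total xs g))
  where
  interchange : ∀ a b c d → a + b + (c + d) ≡ a + c + (b + d)
  interchange a b c d = solve (a ∷ b ∷ c ∷ d ∷ [])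

total-zero : ∀ {f : S → ℕ} xs → (∀ x → f x ≡ 0) → total xs f ≡ 0
total-zero []       _ = refl
total-zero (x ∷ xs) p = cong₂ _+_ (p x) (total-zero xs p)

total-one : ∀ (xs : List S) → total xs (λ _ → 1) ≡ length xs
total-one []       = refl
total-one (x ∷ xs) = cong suc (total-one xs)

total-swap : ∀ (f : S → T → ℕ) xs ys →
  total xs (λ x → total ys (f x)) ≡ total ys (λ y → total xs (λ x → f x y))
total-swap f []       ys = sym (total-zero ys (λ _ → refl))
total-swap f (x ∷ xs) ys = trans (cong (total ys (f x) +_) (total-swap f xs ys))
  (sym (total-+ (f x) (λ y → total xs (λ z → f z y)) ys))

total-∈ : ∀ (f : S → ℕ) {x xs} → x ∈ xs → f x ≤ total xs f
total-∈ f {xs = y ∷ ys} (here refl) = m≤m+n (f y) _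
total-∈ f {xs = y ∷ ys} (there i)   = ≤-trans (total-∈ f i) (m≤n+m _ (f y))

total-allFin : ∀ {n} (f : Fin (suc n) → ℕ) →
  total (allFin (suc n)) f ≡ f zero + total (allFin n) (f ∘ suc)
total-allFin {n} f = cong (λ xs → f zero + sum xs)
  (trans (map-tabulate suc f) (sym (map-tabulate id (f ∘ suc))))

-- Vertex sets as Boolean predicates.

VSet : ℕ → Set
VSet n = Fin n → Bool

infixr 7 _∩_
infixr 6 _∪_

-- Opaque, so that unification can read the arguments off a compound set.
opaque

  _∩_ _∪_ : ∀ {n} → VSet n → VSet n → VSet n
  (X ∩ Y) x = X x ∧ Y x
  (X ∪ Y) x = X x ∨ Y x

  ∁ : ∀ {n} → VSet n → VSet n
  ∁ X x = not (X x)

  ⁅_⁆ : ∀ {n} → Fin n → VSet n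
  ⁅ v ⁆ x = ⌊ x ≟ v ⌋

full : ∀ {n} → VSet n
full _ = true

infix 4 _∈ˢ_ _∉ˢ_ _⊆_
-- A record rather than a bare equation, so that `x` and `X` can be inferred from a membership
-- proof.
record _∈ˢ_ {n} (x : Fin n) (X : VSet n) : Set where
  constructor member
  field holds : X x ≡ true
open _∈ˢ_

_∉ˢ_ : ∀ {n} → Fin n → VSet n → Set
x ∉ˢ X = ¬ x ∈ˢ X

_⊆_ : ∀ {n} → VSet n → VSet n → Set
X ⊆ Y = ∀ {x} → x ∈ˢ X → x ∈ˢ Y

Disjoint : ∀ {n} → VSet n → VSet n → Set
Disjoint X Y = ∀ {x} → x ∈ˢ X → x ∉ˢ Y

module _ {n : ℕ} where

  _∈?_ : ∀ (x : Fin n) X → Dec (x ∈ˢ X)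
  x ∈? X with decide (X x)
  ... | inj₁ p = yes (member p)
  ... | inj₂ p = no λ { (member q) → conflict q p }

  ∉-false : ∀ {x : Fin n} {X} → x ∉ˢ X → X x ≡ false
  ∉-false {x} {X} p with decide (X x)
  ... | inj₁ q = ⊥-elim (p (member q))
  ... | inj₂ q = q

  ∈full : ∀ {x : Fin n} → x ∈ˢ full
  ∈full = member refl

  opaque
    unfolding _∩_

    ∈∩ : ∀ {x : Fin n} {X Y} → x ∈ˢ X → x ∈ˢ Y → x ∈ˢ X ∩ Y
    ∈∩ {Y = Y} (member p) (member q) = member (trans (cong (_∧ Y _) p) q)

    ∈∩ˡ : ∀ {x : Fin n} {X Y} → x ∈ˢ X ∩ Y → x ∈ˢ X
    ∈∩ˡ {x} {X} {Y} (member p) with X x in eq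
    ... | true = member eq

    ∈∩ʳ : ∀ {x : Fin n} {X Y} → x ∈ˢ X ∩ Y → x ∈ˢ Y
    ∈∩ʳ {x} {X} {Y} (member p) with X x
    ... | true = member p

    ∈∪ˡ : ∀ {x : Fin n} {X Y} → x ∈ˢ X → x ∈ˢ X ∪ Y
    ∈∪ˡ {Y = Y} (member p) = member (cong (_∨ Y _) p)

    ∈∪ʳ : ∀ {x : Fin n} {X Y} → x ∈ˢ Y → x ∈ˢ X ∪ Y
    ∈∪ʳ {x} {X} (member p) with X x in eq
    ... | true  = member (cong (_∨ _) eq)
    ... | false = member (trans (cong (_∨ _) eq) p)

    ∈∪⁻ : ∀ {x : Fin n} {X Y} → x ∈ˢ X ∪ Y → x ∈ˢ X ⊎ x ∈ˢ Y
    ∈∪⁻ {x} {X} (member p) with X x in eq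
    ... | true  = inj₁ (member eq)
    ... | false = inj₂ (member p)

    ∈∁ : ∀ {x : Fin n} {X} → x ∉ˢ X → x ∈ˢ ∁ X
    ∈∁ p = member (cong not (∉-false p))

    ∈∁⁻ : ∀ {x : Fin n} {X} → x ∈ˢ ∁ X → x ∉ˢ X
    ∈∁⁻ {x} {X} (member p) (member q) with X x
    ∈∁⁻ (member ()) _ | true
    ∈∁⁻ _ (member ()) | false

    ∈⁅⁆ : ∀ {v : Fin n} → v ∈ˢ ⁅ v ⁆
    ∈⁅⁆ {v} with v ≟ v in eq
    ... | yes _  = member (cong ⌊_⌋ eq)
    ... | no v≢v = ⊥-elim (v≢v refl)

    ∈⁅⁆⁻ : ∀ {v x : Fin n} → x ∈ˢ ⁅ v ⁆ → x ≡ v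
    ∈⁅⁆⁻ {v} {x} (member p) with x ≟ v
    ... | yes eq = eq

  ⁅⁆⊆ : ∀ {v : Fin n} {X} → v ∈ˢ X → ⁅ v ⁆ ⊆ X
  ⁅⁆⊆ {X = X} p q = subst (_∈ˢ X) (sym (∈⁅⁆⁻ q)) p

  everywhere : ∀ {P : Fin n → Set} → (∀ x → P x) → All P (allFin n)
  everywhere p = All.tabulate (λ {x} _ → p x)

-- Cardinalities of vertex sets.

opaque

  card : ∀ {n} → VSet n → ℕ
  card {n} X = total (allFin n) (bit ∘ X)

  card-total : ∀ {n} (X : VSet n) → card X ≡ total (allFin n) (bit ∘ X)
  card-total X = refl

  card-mono : ∀ {n} {X Y : VSet n} → X ⊆ Y → card X ≤ card Y
  card-mono X⊆Y = total-mono (everywhere λ x → bit-mono (λ p → holds (X⊆Y {x} (member p))))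

  card-cover : ∀ {n} {X Y Z : VSet n} → (∀ {x} → x ∈ˢ X → x ∈ˢ Y ⊎ x ∈ˢ Z) →
    card X ≤ card Y + card Z
  card-cover {n} {X} {Y} {Z} p = ≤-trans
    (total-mono (everywhere λ x → bit-cover (λ q → ⊎-map holds holds (p {x} (member q)))))
    (≤-reflexive (total-+ (bit ∘ Y) (bit ∘ Z) (allFin n)))

  card-disjoint : ∀ {n} {X Y Z : VSet n} → Disjoint X Y → X ⊆ Z → Y ⊆ Z → card X + card Y ≤ card Z
  card-disjoint {n} {X} {Y} {Z} d X⊆Z Y⊆Z = ≤-trans
    (≤-reflexive (sym (total-+ (bit ∘ X) (bit ∘ Y) (allFin n))))
    (total-mono (everywhere pointwise))
    where
    pointwise : ∀ x → bit (X x) + bit (Y x) ≤ bit (Z x)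
    pointwise x with x ∈? X
    ... | yes p rewrite holds p | ∉-false (d p) | holds (X⊆Z p) = ≤-refl
    ... | no p rewrite ∉-false p = bit-mono (λ q → holds (Y⊆Z (member q)))

  ∈⇒card : ∀ {n} {X : VSet n} {x} → x ∈ˢ X → 1 ≤ card X
  ∈⇒card {X = X} {x} p = ≤-trans (≤-reflexive (cong bit (sym (holds p)))) (total-∈ (bit ∘ X) (∈-allFin x))

  card-full : ∀ n → card {n} full ≡ n
  card-full n = trans (total-one (allFin n)) (length-tabulate id)

  card-suc : ∀ {n} (X : VSet (suc n)) → card X ≡ bit (X zero) + card (X ∘ suc)
  card-suc X = total-allFin (bit ∘ X)

  card-empty : ∀ {n} {X : VSet n} → (∀ {x} → x ∉ˢ X) → card X ≡ 0
  card-empty {n} p = total-zero (allFin n) (λ x → cong bit (∉-false p))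

card-≡ : ∀ {n} {X Y : VSet n} → X ⊆ Y → Y ⊆ X → card X ≡ card Y
card-≡ X⊆Y Y⊆X = ≤-antisym (card-mono X⊆Y) (card-mono Y⊆X)

card-partition : ∀ {n} {X Y Z : VSet n} → (∀ {x} → x ∈ˢ X → x ∈ˢ Y ⊎ x ∈ˢ Z) →
  Disjoint Y Z → Y ⊆ X → Z ⊆ X → card X ≡ card Y + card Z
card-partition c d Y⊆X Z⊆X = ≤-antisym (card-cover c) (card-disjoint d Y⊆X Z⊆X)

card-∅ : ∀ {n} {X : VSet n} → card X ≡ 0 → ∀ {x} → x ∉ˢ X
card-∅ c p = absurd (subst (1 ≤_) c (∈⇒card p))

inhabited : ∀ {n} {X : VSet n} → 1 ≤ card X → ∃ (_∈ˢ X)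
inhabited {zero}  {X} p = absurd (≤-trans p (≤-reflexive (card-total X)))
inhabited {suc n} {X} p with decide (X zero)
... | inj₁ q = zero , member q
... | inj₂ q with inhabited {X = X ∘ suc} (≤-trans p (≤-reflexive
                    (trans (card-suc X) (cong (λ b → bit b + card (X ∘ suc)) q))))
...   | x , member r = suc x , member r

opaque
  unfolding ⁅_⁆

  card-⁅⁆ : ∀ {n} (v : Fin n) → card ⁅ v ⁆ ≡ 1
  card-⁅⁆ {suc n} zero = trans (card-suc ⁅ zero ⁆) (cong suc (card-empty none))
    where
    none : ∀ {x : Fin n} → x ∉ˢ ⁅ zero ⁆ ∘ suc
    none (member ())
  card-⁅⁆ {suc n} (suc v) = trans (card-suc ⁅ suc v ⁆)
    (trans (card-≡ (λ { (member p) → member (trans (sym (suc-≟ _)) p) })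
                   (λ { (member p) → member (trans (suc-≟ _) p) })) (card-⁅⁆ v))
    where
    suc-≟ : ∀ x → ⁅ suc v ⁆ (suc x) ≡ ⁅ v ⁆ x
    suc-≟ x with x ≟ v
    ... | yes _ = refl
    ... | no _  = refl

module _ {n : ℕ} where

  card-insert : ∀ {X : VSet n} {v} → v ∉ˢ X → card (X ∪ ⁅ v ⁆) ≡ suc (card X)
  card-insert {X} {v} v∉X = trans
    (card-partition ∈∪⁻ (λ p q → v∉X (subst (_∈ˢ X) (∈⁅⁆⁻ q) p)) ∈∪ˡ ∈∪ʳ)
    (trans (cong (card X +_) (card-⁅⁆ v)) (+-comm (card X) 1))

  -- A vertex of `Y` outside `X` would make `Y` larger than `X` by at least one.
  ⊆-card⇒⊇ : ∀ {X Y : VSet n} → X ⊆ Y → card Y ≤ card X → Y ⊆ X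
  ⊆-card⇒⊇ {X} {Y} X⊆Y c {x} y with x ∈? X
  ... | yes p = p
  ... | no p  = absurd (linear 0 (bound ⊕ c) (eq (card X) (card Y)))
    where
    bound : suc (card X) ≤ card Y
    bound = subst (_≤ card Y) (card-insert p) (card-mono ([ X⊆Y , ⁅⁆⊆ y ]′ ∘ ∈∪⁻))
    eq : ∀ a b → 1 + (b + a) + 0 ≡ 0 + (suc a + b)
    eq a b = solve (a ∷ b ∷ [])

  card-pair : ∀ {X : VSet n} {x y} → x ≢ y → x ∈ˢ X → y ∈ˢ X → 2 ≤ card X
  card-pair {X} {x} {y} x≢y p q = subst (_≤ card X) (cong₂ _+_ (card-⁅⁆ x) (card-⁅⁆ y))
    (card-disjoint (λ r s → x≢y (trans (sym (∈⁅⁆⁻ r)) (∈⁅⁆⁻ s))) (⁅⁆⊆ p) (⁅⁆⊆ q))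

-- Edges inside a vertex set, and sparsity.

Within : ∀ {n} → VSet n → Edge n → Set
Within X (x , y) = x ∈ˢ X × y ∈ˢ X

module _ {n : ℕ} where

  within : VSet n → Edge n → Bool
  within X (x , y) = X x ∧ X y

  within⁻ : ∀ X (e : Edge n) → within X e ≡ true → Within X e
  within⁻ X (x , y) p with X x in eq
  ... | true = member eq , member p

  within⁺ : ∀ X (e : Edge n) → Within X e → within X e ≡ true
  within⁺ X (x , y) (member p , member q) = trans (cong (_∧ X y) p) q

  within? : ∀ X (e : Edge n) → Dec (Within X e)
  within? X (x , y) = (x ∈? X) ×-dec (y ∈? X)

  opaque

    inside : List (Edge n) → VSet n → ℕ
    inside es X = total es (bit ∘ within X)

    inside-[] : ∀ {X} → inside [] X ≡ 0
    inside-[] = refl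

    inside-cover : ∀ {X Y Z es} → All (λ e → Within X e → Within Y e ⊎ Within Z e) es →
      inside es X ≤ inside es Y + inside es Z
    inside-cover {X} {Y} {Z} {es} p = ≤-trans
      (total-mono (All.map (λ {e} f → bit-cover {within X e} λ q →
        ⊎-map (within⁺ Y e) (within⁺ Z e) (f (within⁻ X e q))) p))
      (≤-reflexive (total-+ (bit ∘ within Y) (bit ∘ within Z) es))

    inside-mono : ∀ {X Y es} → All (λ e → Within X e → Within Y e) es → inside es X ≤ inside es Y
    inside-mono {X} {Y} p = total-mono
      (All.map (λ {e} f → bit-mono {within X e} (λ q → within⁺ Y e (f (within⁻ X e q)))) p)

    inside-none : ∀ {X es} → All (λ e → ¬ Within X e) es → inside es X ≡ 0
    inside-none []ᴬ = refl
    inside-none {X} (_∷ᴬ_ {x = e} p ps) with within X e in eq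
    ... | true  = ⊥-elim (p (within⁻ X e eq))
    ... | false = inside-none ps

    inside-full : ∀ es → inside es full ≡ length es
    inside-full = total-one

    inside-∷-∉ : ∀ {X e es} → ¬ Within X e → inside (e ∷ es) X ≡ inside es X
    inside-∷-∉ {X} {e} p with within X e in eq
    ... | true  = ⊥-elim (p (within⁻ X e eq))
    ... | false = refl

    inside-∷-≤ : ∀ {X e es} → inside (e ∷ es) X ≤ suc (inside es X)
    inside-∷-≤ {X} {e} {es} with within X e
    ... | true  = ≤-refl
    ... | false = n≤1+n _

  -- Laman's (2,3)-sparsity from planar rigidity, with the 3 on the left to avoid truncated
  -- subtraction. Sets attaining the bound are the rigid ones below.
  Sparse : List (Edge n) → Set
  Sparse es = ∀ {X} → 2 ≤ card X → inside es X + 3 ≤ 2 * card X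

  enlarge : ∀ {es} → Sparse es → ∀ {X v} → v ∉ˢ X → 1 ≤ card X →
    inside es (X ∪ ⁅ v ⁆) + 3 ≤ 2 * suc (card X)
  enlarge {es} sparse {X} {v} v∉X 1≤X = subst (λ k → inside es (X ∪ ⁅ v ⁆) + 3 ≤ 2 * k)
    (card-insert v∉X) (sparse (≤-trans (s≤s 1≤X) (≤-reflexive (sym (card-insert v∉X)))))

-- Balanced cuts

record Cut (n s : ℕ) : Set where
  field
    A B        : VSet n
    centre     : Fin n
    trichotomy : ∀ x → x ≡ centre ⊎ x ∈ˢ A ⊎ x ∈ˢ B
    A∩B        : Disjoint A B
    centre∉A   : centre ∉ˢ A
    centre∉B   : centre ∉ˢ B
    card-A     : card A ≡ s
    card-B     : card B ≡ s

open Cut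

module _ {n s : ℕ} where

  flip : Cut n s → Cut n s
  flip c = record
    { A          = B c
    ; B          = A c
    ; centre     = centre c
    ; trichotomy = λ x → ⊎-map id ⊎-swap (trichotomy c x)
    ; A∩B        = λ b a → A∩B c a b
    ; centre∉A   = centre∉B c
    ; centre∉B   = centre∉A c
    ; card-A     = card-B c
    ; card-B     = card-A c
    }

  Crosses Avoids : Cut n s → Edge n → Set
  Crosses c (x , y) = (x ∈ˢ A c × y ∈ˢ B c) ⊎ (x ∈ˢ B c × y ∈ˢ A c)
  Avoids c e = ¬ Crosses c e

  flip-Avoids : ∀ {c es} → All (Avoids c) es → All (Avoids (flip c)) es
  flip-Avoids = All.map (_∘ ⊎-swap)

  module _ (c : Cut n s) where

    crosses-≢ : ∀ {x y} → Crosses c (x , y) → x ≢ y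
    crosses-≢ (inj₁ (a , b)) refl = A∩B c a b
    crosses-≢ (inj₂ (b , a)) refl = A∩B c a b

    centre-split : ∀ {X} → centre c ∉ˢ X → ∀ {x} → x ∈ˢ X → x ∈ˢ X ∩ A c ⊎ x ∈ˢ X ∩ B c
    centre-split v∉X {x} p with trichotomy c x
    ... | inj₁ refl     = ⊥-elim (v∉X p)
    ... | inj₂ (inj₁ a) = inj₁ (∈∩ p a)
    ... | inj₂ (inj₂ b) = inj₂ (∈∩ p b)

    card-centre∉ : ∀ {X} → centre c ∉ˢ X → card X ≡ card (X ∩ A c) + card (X ∩ B c)
    card-centre∉ v∉X = card-partition (centre-split v∉X) (λ p q → A∩B c (∈∩ʳ p) (∈∩ʳ q)) ∈∩ˡ ∈∩ˡ

    card-centre∈ : ∀ {X} → centre c ∈ˢ X → card X ≡ suc (card (X ∩ A c) + card (X ∩ B c))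
    -- `card-centre∉` is applied to `X` without the centre, and `absorb` then restores the traces of
    -- `X` itself.
    card-centre∈ {X} v∈X = trans (card-partition cover disjoint ∈∩ˡ (⁅⁆⊆ v∈X))
      (trans (cong₂ _+_ (card-centre∉ (λ p → v∉A∪B (∈∩ʳ p))) (card-⁅⁆ (centre c)))
        (trans (+-comm _ 1) (cong suc (cong₂ _+_ (absorb ∈∪ˡ) (absorb ∈∪ʳ)))))
      where
      absorb : ∀ {Z W} → Z ⊆ W → card ((X ∩ W) ∩ Z) ≡ card (X ∩ Z)
      absorb {Z} {W} Z⊆W = card-≡ (λ p → ∈∩ (∈∩ˡ (∈∩ˡ p)) (∈∩ʳ p)) (λ p → ∈∩ (∈∩ (∈∩ˡ p) (Z⊆W (∈∩ʳ p))) (∈∩ʳ p))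
      v∉A∪B : centre c ∉ˢ A c ∪ B c
      v∉A∪B p = [ centre∉A c , centre∉B c ]′ (∈∪⁻ p)
      cover : ∀ {x} → x ∈ˢ X → x ∈ˢ X ∩ (A c ∪ B c) ⊎ x ∈ˢ ⁅ centre c ⁆
      cover {x} p with trichotomy c x
      ... | inj₁ refl     = inj₂ ∈⁅⁆
      ... | inj₂ (inj₁ a) = inj₁ (∈∩ p (∈∪ˡ a))
      ... | inj₂ (inj₂ b) = inj₁ (∈∩ p (∈∪ʳ b))
      disjoint : Disjoint (X ∩ (A c ∪ B c)) ⁅ centre c ⁆
      disjoint p q = v∉A∪B (subst (_∈ˢ A c ∪ B c) (∈⁅⁆⁻ q) (∈∩ʳ p))

    -- Edges that avoid the cut never pass between its classes, so the two sides of `X` meet only in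
    -- the centre, which must belong to both parts. `Y` and `Z` are left free so that a further
    -- vertex can be kept on one side only.
    hinge : ∀ {X Y Z es} → All (Avoids c) es → X ∩ A c ⊆ Y → X ∩ B c ⊆ Z →
      (centre c ∈ˢ X → centre c ∈ˢ Y × centre c ∈ˢ Z) →
      inside es X ≤ inside es Y + inside es Z
    hinge {X} {Y} {Z} av XA XB Xv = inside-cover (All.map edge av)
      where
      edge : ∀ {e} → Avoids c e → Within X e → Within Y e ⊎ Within Z e
      edge {x , y} av (p , q) with trichotomy c x | trichotomy c y
      ... | inj₁ refl     | inj₁ refl     = inj₁ (proj₁ (Xv p) , proj₁ (Xv p))
      ... | inj₁ refl     | inj₂ (inj₁ b) = inj₁ (proj₁ (Xv p) , XA (∈∩ q b))
      ... | inj₁ refl     | inj₂ (inj₂ b) = inj₂ (proj₂ (Xv p) , XB (∈∩ q b))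
      ... | inj₂ (inj₁ a) | inj₁ refl     = inj₁ (XA (∈∩ p a) , proj₁ (Xv q))
      ... | inj₂ (inj₂ a) | inj₁ refl     = inj₂ (XB (∈∩ p a) , proj₂ (Xv q))
      ... | inj₂ (inj₁ a) | inj₂ (inj₁ b) = inj₁ (XA (∈∩ p a) , XA (∈∩ q b))
      ... | inj₂ (inj₂ a) | inj₂ (inj₂ b) = inj₂ (XB (∈∩ p a) , XB (∈∩ q b))
      ... | inj₂ (inj₁ a) | inj₂ (inj₂ b) = ⊥-elim (av (inj₁ (a , b)))
      ... | inj₂ (inj₂ a) | inj₂ (inj₁ b) = ⊥-elim (av (inj₂ (a , b)))

    hinge-∉ : ∀ {X es} → All (Avoids c) es → centre c ∉ˢ X →
      inside es X ≤ inside es (X ∩ A c) + inside es (X ∩ B c)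
    hinge-∉ av v∉X = hinge av id id (λ v∈X → ⊥-elim (v∉X v∈X))

    hinge-∈ : ∀ {X es} → All (Avoids c) es →
      inside es X ≤ inside es ((X ∩ A c) ∪ ⁅ centre c ⁆) + inside es ((X ∩ B c) ∪ ⁅ centre c ⁆)
    hinge-∈ av = hinge av ∈∪ˡ ∈∪ˡ (λ _ → ∈∪ʳ ∈⁅⁆ , ∈∪ʳ ∈⁅⁆)

    crossed : ∀ {X e} → Crosses c e → Within X e → 1 ≤ card (X ∩ A c) × 1 ≤ card (X ∩ B c)
    crossed (inj₁ (a , b)) (p , q) = ∈⇒card (∈∩ p a) , ∈⇒card (∈∩ q b)
    crossed (inj₂ (b , a)) (p , q) = ∈⇒card (∈∩ q a) , ∈⇒card (∈∩ p b)

  -- What remains of a valid sequence once the graph is forgotten: when `e` is added, the edges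
  -- still missing are those of `es`, and the new copy is a cut which they all avoid.
  data Peel : List (Edge n) → Set where
    []   : Peel []
    peel : ∀ {e es} (c : Cut n s) → Crosses c e → All (Avoids c) es → Peel es → Peel (e ∷ es)

  loopless : ∀ {es} → Peel es → All (λ e → proj₁ e ≢ proj₂ e) es
  loopless []              = []ᴬ
  loopless (peel c x _ es) = crosses-≢ c x ∷ᴬ loopless es

  inside-single : ∀ {es X} → Peel es → card X ≤ 1 → inside es X ≡ 0
  inside-single {es} {X} p c = inside-none (All.map (λ x≢y (x , y) →
    2≰1 (≤-trans (card-pair x≢y x y) c)) (loopless p))
    where
    2≰1 : ¬ 2 ≤ 1
    2≰1 (s≤s ())

  -- One unit of the bound is given up so that single vertices, which carry no edge, are covered
  -- too.
  weaken : ∀ {es} → Peel es → Sparse es → ∀ {X} → 1 ≤ card X → inside es X + 2 ≤ 2 * card X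
  weaken {es} p sparse {X} c with 2 ≤? card X
  ... | yes d = ≤-trans (linear 1 ≤-refl (eq (inside es X))) (sparse d)
    where
    eq : ∀ i → i + 2 + (i + 3) + 1 ≡ i + 3 + (i + 3)
    eq i = solve (i ∷ [])
  ... | no d  = ≤-trans (≤-reflexive (cong (_+ 2) (inside-single p (≤-pred (≰⇒> d))))) (2 ⊗ c)

  sparse : ∀ {es} → Peel es → Sparse es
  sparse [] {X} c = ≤-trans (≤-reflexive (cong (_+ 3) (inside-[] {X = X}))) (≤-trans (n≤1+n 3) (2 ⊗ c))
  sparse {e ∷ es} (peel c cr av p) {X} 2≤X with within? X e
  ... | no q  = ≤-trans (≤-reflexive (cong (_+ 3) (inside-∷-∉ q))) (sparse p 2≤X)
  ... | yes q = ≤-trans (inside-∷-≤ ⊕ ≤-refl {3}) count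
    where
    -- `e` needs one unit of slack. Disjoint parts lose at least 2 each; parts sharing the centre
    -- lose 3 each, but count it twice, which returns 2. Both ways at most 2|X| - 4 later edges lie
    -- in `X`.
    away : ∀ {i j k m} a b → k ≤ i + j → i + 2 ≤ 2 * a → j + 2 ≤ 2 * b → m ≡ a + b → suc k + 3 ≤ 2 * m
    away {i} {j} {k} a b h₁ h₂ h₃ refl = linear 0 (h₁ ⊕ h₂ ⊕ h₃) (solve (i ∷ j ∷ k ∷ a ∷ b ∷ []))
    through : ∀ {i j k m} a b → k ≤ i + j → i + 3 ≤ 2 * suc a → j + 3 ≤ 2 * suc b → m ≡ suc (a + b) → suc k + 3 ≤ 2 * m
    through {i} {j} {k} a b h₁ h₂ h₃ refl = linear 0 (h₁ ⊕ h₂ ⊕ h₃) (solve (i ∷ j ∷ k ∷ a ∷ b ∷ []))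
    count : suc (inside es X) + 3 ≤ 2 * card X
    count with crossed c cr q | centre c ∈? X
    ... | a , b | no v∉X  = away (card (X ∩ A c)) (card (X ∩ B c)) (hinge-∉ c av v∉X)
      (weaken p (sparse p) a) (weaken p (sparse p) b) (card-centre∉ c v∉X)
    ... | a , b | yes v∈X = through (card (X ∩ A c)) (card (X ∩ B c)) (hinge-∈ c av)
      (enlarge (sparse p) (λ r → centre∉A c (∈∩ʳ r)) a)
      (enlarge (sparse p) (λ r → centre∉B c (∈∩ʳ r)) b) (card-centre∈ c v∈X)

-- Rigid sets

zero-or-positive : ∀ k → k ≡ 0 ⊎ 1 ≤ k
zero-or-positive zero    = inj₁ refl
zero-or-positive (suc k) = inj₂ (s≤s z≤n)

≤1-or-≥2 : ∀ k → k ≤ 1 ⊎ 2 ≤ k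
≤1-or-≥2 zero          = inj₁ z≤n
≤1-or-≥2 (suc zero)    = inj₁ ≤-refl
≤1-or-≥2 (suc (suc k)) = inj₂ (s≤s (s≤s z≤n))

module _ {n s : ℕ} where
  missed : ∀ (c : Cut n s) {X} → centre c ∉ˢ X → card (X ∩ A c) ≡ 0 → X ⊆ B c
  missed c v∉X a≡0 x∈X with centre-split c v∉X x∈X
  ... | inj₁ p = ⊥-elim (card-∅ a≡0 p)
  ... | inj₂ p = ∈∩ʳ p

  -- The parts are disjoint here, and of three vertices two lie on the same side: that part loses 3,
  -- the other at least 2.
  apart : ∀ {es} (c : Cut n s) → Peel {s = s} es → All (Avoids c) es → ∀ {X} → centre c ∉ˢ X →
    1 ≤ card (X ∩ A c) → 1 ≤ card (X ∩ B c) → 3 ≤ card X → inside es X + 5 ≤ 2 * card X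
  apart {es} c p av {X} v∉X 1≤a 1≤b 3≤X with ≤1-or-≥2 (card (X ∩ A c)) | ≤1-or-≥2 (card (X ∩ B c))
  ... | inj₁ a≤1 | inj₁ b≤1 = absurd (tooSmall (subst (3 ≤_) (card-centre∉ c v∉X) 3≤X) a≤1 b≤1)
    where
    tooSmall : ∀ {a b} → 3 ≤ a + b → a ≤ 1 → b ≤ 1 → 1 ≤ 0
    tooSmall {a} {b} h₁ h₂ h₃ = linear 0 (h₁ ⊕ h₂ ⊕ h₃) (solve (a ∷ b ∷ []))
  ... | inj₂ 2≤a | _ = combine (card (X ∩ A c)) (card (X ∩ B c))
    (hinge-∉ c av v∉X) (sparse p 2≤a) (weaken p (sparse p) 1≤b) (card-centre∉ c v∉X)
    where
    combine : ∀ {i j k m} a b → k ≤ i + j → i + 3 ≤ 2 * a → j + 2 ≤ 2 * b → m ≡ a + b → k + 5 ≤ 2 * m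
    combine {i} {j} {k} a b h₁ h₂ h₃ refl = linear 0 (h₁ ⊕ h₂ ⊕ h₃) (solve (i ∷ j ∷ k ∷ a ∷ b ∷ []))
  ... | inj₁ _ | inj₂ 2≤b = combine (card (X ∩ A c)) (card (X ∩ B c))
    (hinge-∉ c av v∉X) (weaken p (sparse p) 1≤a) (sparse p 2≤b) (card-centre∉ c v∉X)
    where
    combine : ∀ {i j k m} a b → k ≤ i + j → i + 2 ≤ 2 * a → j + 3 ≤ 2 * b → m ≡ a + b → k + 5 ≤ 2 * m
    combine {i} {j} {k} a b h₁ h₂ h₃ refl = linear 0 (h₁ ⊕ h₂ ⊕ h₃) (solve (i ∷ j ∷ k ∷ a ∷ b ∷ []))

  -- If the cut split `X`, `apart` would leave at most 2|X| - 5 edges in it, and the single edge `e`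
  -- cannot bring that back to 2|X| - 3.
  unbroken : ∀ {e es} (c : Cut n s) → Peel {s = s} es → All (Avoids c) es → ∀ {X} → centre c ∉ˢ X →
    3 ≤ card X → 2 * card X ≤ inside (e ∷ es) X + 3 → X ⊆ A c ⊎ X ⊆ B c
  unbroken {e} {es} c p av {X} v∉X 3≤X rigid
    with zero-or-positive (card (X ∩ A c)) | zero-or-positive (card (X ∩ B c))
  ... | inj₁ a≡0 | _        = inj₂ (missed c v∉X a≡0)
  ... | inj₂ _   | inj₁ b≡0 = inj₁ (missed (flip c) v∉X b≡0)
  ... | inj₂ 1≤a | inj₂ 1≤b = absurd (clash (card X) rigid inside-∷-≤ (apart c p av v∉X 1≤a 1≤b 3≤X))
    where
    clash : ∀ {i j} m → 2 * m ≤ i + 3 → i ≤ suc j → j + 5 ≤ 2 * m → 1 ≤ 0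
    clash {i} {j} m h₁ h₂ h₃ = linear 0 (h₁ ⊕ h₂ ⊕ h₃) (solve (i ∷ j ∷ m ∷ []))

  -- X is then a whole class of the cut, so the crossing edge has exactly one end in X.
  leaving : ∀ {e} (c : Cut n s) → Crosses c e → ∀ {X Y} → Disjoint X Y → card X ≡ s →
    X ⊆ A c ⊎ X ⊆ B c → ¬ Within X e × ¬ Within Y e
  leaving c cr {X} {Y} dis sX (inj₁ X⊆A) = inX cr , inY cr
    where
    A⊆X : A c ⊆ X
    A⊆X = ⊆-card⇒⊇ X⊆A (≤-reflexive (trans (card-A c) (sym sX)))
    inX : ∀ {e} → Crosses c e → ¬ Within X e
    inX (inj₁ (_ , b)) (_ , y) = A∩B c (X⊆A y) b
    inX (inj₂ (b , _)) (x , _) = A∩B c (X⊆A x) b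
    inY : ∀ {e} → Crosses c e → ¬ Within Y e
    inY (inj₁ (a , _)) (x , _) = dis (A⊆X a) x
    inY (inj₂ (_ , a)) (_ , y) = dis (A⊆X a) y
  leaving c cr dis sX (inj₂ X⊆B) = leaving (flip c) (⊎-swap cr) dis sX (inj₁ X⊆B)

  -- The centre misses one of the two sets; being rigid, that set stays whole and fills a class. So
  -- `e` is inside neither set, both keep all their edges, and the induction runs down to the empty
  -- list, where none remain.
  rigid-pair : ∀ {es} → Peel {s = s} es → 3 ≤ s → ∀ {X Y} → Disjoint X Y → card X ≡ s → card Y ≡ s →
    2 * s ≤ inside es X + 3 → 2 * s ≤ inside es Y + 3 → ⊥
  rigid-pair [] 3≤s {X} _ _ _ rX _ = absurd (small 3≤s (≤-trans rX (≤-reflexive (cong (_+ 3) inside-[]))))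
    where
    small : 3 ≤ s → 2 * s ≤ 3 → 1 ≤ 0
    small h₁ h₂ = linear 2 (2 ⊗ h₁ ⊕ h₂) (solve (s ∷ []))
  rigid-pair {e ∷ es} (peel c cr av p) 3≤s {X} {Y} dis sX sY rX rY = recurse ends
    where
    ends : ¬ Within X e × ¬ Within Y e
    ends with centre c ∈? X
    ... | no v∉X  = leaving c cr dis sX (unbroken c p av v∉X (subst (3 ≤_) (sym sX) 3≤s)
                      (subst (λ k → 2 * k ≤ inside (e ∷ es) X + 3) (sym sX) rX))
    ... | yes v∈X with leaving c cr (λ y x → dis x y) sY (unbroken c p av (dis v∈X) (subst (3 ≤_) (sym sY) 3≤s)
                      (subst (λ k → 2 * k ≤ inside (e ∷ es) Y + 3) (sym sY) rY))
    ...   | e∉Y , e∉X = e∉X , e∉Y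
    recurse : ¬ Within X e × ¬ Within Y e → ⊥
    recurse (e∉X , e∉Y) = rigid-pair p 3≤s dis sX sY
      (subst (λ k → 2 * s ≤ k + 3) (inside-∷-∉ e∉X) rX)
      (subst (λ k → 2 * s ≤ k + 3) (inside-∷-∉ e∉Y) rY)

  length-cover : ∀ {X Y} {es : List (Edge n)} → All (λ e → Within X e ⊎ Within Y e) es →
    length es ≤ inside es X + inside es Y
  length-cover {es = es} p = ≤-trans (≤-reflexive (sym (inside-full es))) (inside-cover (All.map (λ h _ → h) p))

  card-halves : ∀ {X Y : VSet n} → Disjoint X Y → (∀ x → x ∈ˢ X ⊎ x ∈ˢ Y) → ∀ Z → card Z ≡ card (X ∩ Z) + card (Y ∩ Z)
  card-halves dis cover Z = card-partition
    (λ {x} z → ⊎-map (λ h → ∈∩ h z) (λ h → ∈∩ h z) (cover x)) (λ p q → dis (∈∩ˡ p) (∈∩ˡ q)) ∈∩ʳ ∈∩ʳ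

  module _ (3≤s : 3 ≤ s) {X Y : VSet n} (dis : Disjoint X Y) (sX : card X ≡ s) (sY : card Y ≡ suc s) where

    -- `Y` lies in the two classes, so s of its s + 1 vertices fill `B c`. The one in `A c` has no
    -- edge left inside `Y`, so the density makes both `X` and `Y ∩ B c` rigid.
    pinched : ∀ {es} (c : Cut n s) → Peel {s = s} es → All (Avoids c) es → centre c ∉ˢ Y →
      card (Y ∩ A c) ≤ 1 → 4 * s ≤ inside es X + inside es Y + 6 → ⊥
    pinched {es} c p av v∉Y a≤1 dense = rigid-pair p 3≤s {X} {Y ∩ B c}
      (λ x y → dis x (∈∩ˡ y)) sX b≡s (rigid₁ dense split xs ys) (rigid₂ dense split xs ys)
      where
      b≡s : card (Y ∩ B c) ≡ s
      b≡s = ≤-antisym (≤-trans (card-mono ∈∩ʳ) (≤-reflexive (card-B c))) (large (trans (sym sY) (card-centre∉ c v∉Y)) a≤1)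
        where
        large : ∀ {a b} → suc s ≡ a + b → a ≤ 1 → s ≤ b
        large {a} {b} h₁ h₂ = linear 0 (≤-reflexive h₁ ⊕ h₂) (solve (a ∷ b ∷ s ∷ []))
      split : inside es Y ≤ inside es (Y ∩ B c)
      split = subst (λ k → inside es Y ≤ k + inside es (Y ∩ B c)) (inside-single p a≤1) (hinge-∉ c av v∉Y)
      two≤s : 2 ≤ s
      two≤s = ≤-trans (n≤1+n 2) 3≤s
      xs : inside es X + 3 ≤ 2 * s
      xs = subst (λ k → inside es X + 3 ≤ 2 * k) sX (sparse p (subst (2 ≤_) (sym sX) two≤s))
      ys : inside es (Y ∩ B c) + 3 ≤ 2 * s
      ys = subst (λ k → inside es (Y ∩ B c) + 3 ≤ 2 * k) b≡s (sparse p (subst (2 ≤_) (sym b≡s) two≤s))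
      rigid₁ : ∀ {i j k} → 4 * s ≤ i + j + 6 → j ≤ k → i + 3 ≤ 2 * s → k + 3 ≤ 2 * s → 2 * s ≤ i + 3
      rigid₁ {i} {j} {k} h₁ h₂ h₃ h₄ = linear 0 (h₁ ⊕ h₂ ⊕ h₄) (solve (i ∷ j ∷ k ∷ s ∷ []))
      rigid₂ : ∀ {i j k} → 4 * s ≤ i + j + 6 → j ≤ k → i + 3 ≤ 2 * s → k + 3 ≤ 2 * s → 2 * s ≤ k + 3
      rigid₂ {i} {j} {k} h₁ h₂ h₃ h₄ = linear 0 (h₁ ⊕ h₂ ⊕ h₃) (solve (i ∷ j ∷ k ∷ s ∷ []))

    -- `X` and `Y` can hold 4s - 4 edges in all, so at most one is wanting, and 4s - 6 must remain
    -- after `e`. If the centre is in `Y`, either `X` is a class, which `e` rules out, or splitting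
    -- `X` leaves at most 4s - 7. If it is in `X`, either a vertex of `Y` is pinched off or again at
    -- most 4s - 7 are left.
    detached-pair : ∀ {es} → Peel {s = s} es → (∀ x → x ∈ˢ X ⊎ x ∈ˢ Y) →
      All (λ e → Within X e ⊎ Within Y e) es → 4 * s ≤ length es + 5 → ⊥
    detached-pair [] _ _ dense = absurd (small 3≤s dense)
      where
      small : 3 ≤ s → 4 * s ≤ 5 → 1 ≤ 0
      small h₁ h₂ = linear 6 (4 ⊗ h₁ ⊕ h₂) (solve (s ∷ []))
    detached-pair {e ∷ es} (peel c cr av p) cover (h ∷ᴬ hs) dense = conclude (centre c ∈? Y)
      where
      dense′ : 4 * s ≤ inside es X + inside es Y + 6
      dense′ = step (length-cover hs) dense
        where
        step : ∀ {l m} → l ≤ m → 4 * s ≤ suc l + 5 → 4 * s ≤ m + 6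
        step {l} {m} h₁ h₂ = linear 0 (h₁ ⊕ h₂) (solve (l ∷ m ∷ s ∷ []))
      within-none : X ⊆ A c ⊎ X ⊆ B c → ⊥
      within-none h′ with leaving c cr dis sX h′
      ... | e∉X , e∉Y = [ e∉X , e∉Y ]′ h
      balance : ∀ Z → card Z ≡ s → card (X ∩ Z) + card (Y ∩ Z) ≡ s
      balance Z sZ = trans (sym (card-halves dis cover Z)) sZ
      a b a′ b′ : ℕ
      a  = card (X ∩ A c)
      b  = card (X ∩ B c)
      a′ = card (Y ∩ A c)
      b′ = card (Y ∩ B c)
      conclude : Dec (centre c ∈ˢ Y) → ⊥
      conclude (yes v∈Y) with zero-or-positive a | zero-or-positive b
      ... | inj₁ a≡0 | _        = within-none (inj₂ (missed c (λ x → dis x v∈Y) a≡0))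
      ... | inj₂ _   | inj₁ b≡0 = within-none (inj₁ (missed (flip c) (λ x → dis x v∈Y) b≡0))
      ... | inj₂ 1≤a | inj₂ 1≤b = absurd (clash a b a′ b′ dense′
              (subst (λ k → inside es X + 5 ≤ 2 * k) sX (apart c p av v∉X 1≤a 1≤b (subst (3 ≤_) (sym sX) 3≤s)))
              (hinge-∈ c av)
              (enlarge (sparse p) (λ r → centre∉A c (∈∩ʳ r)) (shift a b 1≤b a+b (balance (A c) (card-A c))))
              (enlarge (sparse p) (λ r → centre∉B c (∈∩ʳ r)) (shift b a 1≤a (trans (+-comm b a) a+b) (balance (B c) (card-B c))))
              (+-cancelˡ-≡ 1 _ _ (trans (sym (card-centre∈ c v∈Y)) sY)))
        where
        v∉X : centre c ∉ˢ X
        v∉X x = dis x v∈Y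
        a+b : a + b ≡ s
        a+b = trans (sym (card-centre∉ c v∉X)) sX
        -- `X` and `A c` both have s vertices and share `a` of them, so `a′` equals `b`; likewise
        -- `b′` equals `a`. Hence both traces of `Y` are nonempty.
        shift : ∀ k l {m} → 1 ≤ l → k + l ≡ s → k + m ≡ s → 1 ≤ m
        shift k l {m} h₁ h₂ h₃ = subst (1 ≤_) (+-cancelˡ-≡ k l m (trans h₂ (sym h₃))) h₁
        clash : ∀ {i j k l} a b a′ b′ → 4 * s ≤ i + j + 6 → i + 5 ≤ 2 * s → j ≤ k + l →
          k + 3 ≤ 2 * suc a′ → l + 3 ≤ 2 * suc b′ → a′ + b′ ≡ s → 1 ≤ 0
        clash {i} {j} {k} {l} a b a′ b′ h₁ h₂ h₃ h₄ h₅ h₆ =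
          linear 0 (h₁ ⊕ h₂ ⊕ h₃ ⊕ h₄ ⊕ h₅ ⊕ 2 ⊗ ≤-reflexive h₆) (solve (i ∷ j ∷ k ∷ l ∷ a′ ∷ b′ ∷ s ∷ []))
      conclude (no v∉Y) with ≤1-or-≥2 a′ | ≤1-or-≥2 b′
      ... | inj₁ a′≤1 | _ = pinched c p av v∉Y a′≤1 dense′
      ... | inj₂ _ | inj₁ b′≤1 = pinched (flip c) p (flip-Avoids {c = c} av) v∉Y b′≤1 dense′
      ... | inj₂ 2≤a′ | inj₂ 2≤b′ = absurd (clash a′ b′ dense′
              (subst (λ k → inside es X + 3 ≤ 2 * k) sX (sparse p (subst (2 ≤_) (sym sX) (≤-trans (n≤1+n 2) 3≤s))))
              (hinge-∉ c av v∉Y) (sparse p 2≤a′) (sparse p 2≤b′) (trans (sym (card-centre∉ c v∉Y)) sY))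
        where
        clash : ∀ {i j k l} a′ b′ → 4 * s ≤ i + j + 6 → i + 3 ≤ 2 * s → j ≤ k + l →
          k + 3 ≤ 2 * a′ → l + 3 ≤ 2 * b′ → a′ + b′ ≡ suc s → 1 ≤ 0
        clash {i} {j} {k} {l} a′ b′ h₁ h₂ h₃ h₄ h₅ h₆ =
          linear 0 (h₁ ⊕ h₂ ⊕ h₃ ⊕ h₄ ⊕ h₅ ⊕ 2 ⊗ ≤-reflexive h₆) (solve (i ∷ j ∷ k ∷ l ∷ a′ ∷ b′ ∷ s ∷ []))

-- Cells around a vertex

module _ {n : ℕ} (s : ℕ) (es : List (Edge n)) where

  -- The tree of successive splits made by cuts around a common centre. No edge of `es` inside the
  -- root joins two leaves, and a leaf, having fewer than s vertices, cannot contain a whole class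
  -- of a cut.
  data Cells : VSet n → ℕ → Set where
    cell : ∀ {W} → 1 ≤ card W → card W < s → Cells W 1
    node : ∀ {W W₁ W₂ k l} → (∀ {x} → x ∈ˢ W → x ∈ˢ W₁ ⊎ x ∈ˢ W₂) → Disjoint W₁ W₂ → W₁ ⊆ W → W₂ ⊆ W →
      All (λ e → Within W e → Within W₁ e ⊎ Within W₂ e) es → Cells W₁ k → Cells W₂ l → Cells W (k + l)

module _ {n s : ℕ} where
  cells-tail : ∀ {e es} {W : VSet n} {k} → Cells s (e ∷ es) W k → Cells s es W k
  cells-tail (cell p q) = cell p q
  cells-tail (node cov dis i j (_ ∷ᴬ sep) f g) = node cov dis i j sep (cells-tail f) (cells-tail g)

  cells-count : ∀ {es} {W : VSet n} {k} → Cells s es W k → k ≤ card W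
  cells-count (cell p _) = p
  cells-count (node _ dis i j _ f g) = ≤-trans (cells-count f ⊕ cells-count g) (card-disjoint dis i j)

  cut-node : ∀ (c : Cut n s) {es W k l} → All (Avoids c) es → centre c ∉ˢ W →
    Cells s es (W ∩ A c) k → Cells s es (W ∩ B c) l → Cells s es W (k + l)
  cut-node c {W = W} av v∉W = node (centre-split c v∉W) (λ p q → A∩B c (∈∩ʳ p) (∈∩ʳ q)) ∈∩ˡ ∈∩ˡ (All.map edge av)
    where
    edge : ∀ {e} → Avoids c e → Within W e → Within (W ∩ A c) e ⊎ Within (W ∩ B c) e
    edge av (p , q) with centre-split c v∉W p | centre-split c v∉W q
    ... | inj₁ a | inj₁ b = inj₁ (a , b)
    ... | inj₂ a | inj₂ b = inj₂ (a , b)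
    ... | inj₁ a | inj₂ b = ⊥-elim (av (inj₁ (∈∩ʳ a , ∈∩ʳ b)))
    ... | inj₂ a | inj₁ b = ⊥-elim (av (inj₂ (∈∩ʳ a , ∈∩ʳ b)))

  -- `e` descends to the one leaf containing both its ends, and this leaf alone is split. Both
  -- traces are nonempty because `e` crosses, so exactly one cell is gained.
  refine : ∀ (c : Cut n s) {e es W k} → Crosses c e → All (Avoids c) es → centre c ∉ˢ W → Within W e →
    Cells s (e ∷ es) W k → Cells s es W (suc k)
  refine c cr av v∉W w (cell _ q) = cut-node c av v∉W
    (cell (proj₁ (crossed c cr w)) (≤-trans (s≤s (card-mono ∈∩ˡ)) q))
    (cell (proj₂ (crossed c cr w)) (≤-trans (s≤s (card-mono ∈∩ˡ)) q))
  refine c {es = es} {W} cr av v∉W w (node {k = k} {l} cov dis i j (h ∷ᴬ sep) f g) with h w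
  ... | inj₁ w₁ = node cov dis i j sep (refine c cr av (λ p → v∉W (i p)) w₁ f) (cells-tail g)
  ... | inj₂ w₂ = subst (Cells s es W) (+-suc k l)
    (node cov dis i j sep (cells-tail f) (refine c cr av (λ p → v∉W (j p)) w₂ g))

  -- `v` acts as a hinge: an edge at `v` follows its other end, and no other edge passes between the
  -- parts.
  cells-inside : ∀ {es} {W W₁ W₂ : VSet n} {v} → (∀ {x} → x ∈ˢ W → x ∈ˢ W₁ ⊎ x ∈ˢ W₂) →
    All (λ e → Within W e → Within W₁ e ⊎ Within W₂ e) es →
    inside es (W ∪ ⁅ v ⁆) ≤ inside es (W₁ ∪ ⁅ v ⁆) + inside es (W₂ ∪ ⁅ v ⁆)
  cells-inside {W = W} {W₁} {W₂} {v} cov sep = inside-cover (All.map edge sep)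
    where
    edge : ∀ {e} → (Within W e → Within W₁ e ⊎ Within W₂ e) →
      Within (W ∪ ⁅ v ⁆) e → Within (W₁ ∪ ⁅ v ⁆) e ⊎ Within (W₂ ∪ ⁅ v ⁆) e
    edge h (p , q) with ∈∪⁻ p | ∈∪⁻ q
    ... | inj₂ x | inj₂ y = inj₁ (∈∪ʳ x , ∈∪ʳ y)
    ... | inj₁ x | inj₂ y = ⊎-map (λ z → ∈∪ˡ z , ∈∪ʳ y) (λ z → ∈∪ˡ z , ∈∪ʳ y) (cov x)
    ... | inj₂ x | inj₁ y = ⊎-map (λ z → ∈∪ʳ x , ∈∪ˡ z) (λ z → ∈∪ʳ x , ∈∪ˡ z) (cov y)
    ... | inj₁ x | inj₁ y = ⊎-map (λ (z , t) → ∈∪ˡ z , ∈∪ˡ t) (λ (z , t) → ∈∪ˡ z , ∈∪ˡ t) (h (x , y))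

  -- Bounds the number a of vertices of a cut class inside a set W of k cells around v when the edges of
  -- W + v fall l short of the maximum 2|W| - k; b is 1, or s - 2 if W contains the centre of the cut.
  Reach : ℕ → ℕ → ℕ → Set
  Reach b zero                a = a ≤ 0
  Reach b (suc zero)          a = a ≤ b
  Reach b (suc (suc zero))    a = a < s
  Reach b (suc (suc (suc _))) a = ⊤

  -- Shortfalls and class vertices both add up, and from a shortfall of 3 on nothing is promised.
  -- The case 1 + 1 is what requires `b + 2 ≤ s`: its b + 1 vertices must stay below s.
  reach-+ : ∀ {b l l′ a a′} → 1 ≤ b → b + 2 ≤ s → Reach b l a → Reach 1 l′ a′ → Reach b (l + l′) (a + a′)
  reach-+ {b} {0} {0} _ _ h h′ = h ⊕ h′
  reach-+ {b} {0} {1} 1≤b _ h h′ = ≤-trans (h ⊕ h′) 1≤b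
  reach-+ {b} {0} {2} {zero} _ _ h h′ = h′
  reach-+ {b} {0} {suc (suc (suc l′))} _ _ h h′ = tt
  reach-+ {b} {1} {0} {a} {a′} _ _ h h′ = ≤-trans (h ⊕ h′) (≤-reflexive (+-identityʳ b))
  reach-+ {b} {1} {1} _ b+2≤s h h′ = ≤-trans (s≤s (h ⊕ h′)) (≤-trans (≤-reflexive (sym (+-suc b 1))) b+2≤s)
  reach-+ {b} {1} {suc (suc l′)} _ _ h h′ = tt
  reach-+ {b} {2} {0} {a} {zero} _ _ h h′ = ≤-trans (≤-reflexive (cong suc (+-identityʳ a))) h
  reach-+ {b} {2} {suc l′} _ _ h h′ = tt
  reach-+ {b} {suc (suc (suc l))} _ _ h h′ = tt

  -- A cell of w vertices together with `v` carries at most 2(w + 1) - 3 = 2w - 1 edges; summing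
  -- over the cells gives the 2|W| - k from which `l` is deducted.
  Priced : List (Edge n) → Cut n s → Fin n → ℕ → VSet n → ℕ → Set
  Priced es c v b W k = ∃ λ l → inside es (W ∪ ⁅ v ⁆) + k + l ≤ 2 * card W × Reach b l (card (W ∩ A c))

  -- The centre lies in at most one part, here `W₁`; the other is always priced with 1.
  merge : ∀ {es c v b W W₁ W₂ k k′} → 1 ≤ b → b + 2 ≤ s → card W ≡ card W₁ + card W₂ →
    card (W ∩ A c) ≡ card (W₁ ∩ A c) + card (W₂ ∩ A c) →
    inside es (W ∪ ⁅ v ⁆) ≤ inside es (W₁ ∪ ⁅ v ⁆) + inside es (W₂ ∪ ⁅ v ⁆) →
    Priced es c v b W₁ k → Priced es c v 1 W₂ k′ → Priced es c v b W (k + k′)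
  merge {es} {c} {v} {b} {W} {W₁} {W₂} {k} {k′} 1≤b b+2≤s cW cWA i (l , h , r) (l′ , h′ , r′) = l + l′ ,
    subst (λ m → inside es (W ∪ ⁅ v ⁆) + (k + k′) + (l + l′) ≤ 2 * m) (sym cW) (add (card W₁) (card W₂) i h h′) ,
    subst (Reach b (l + l′)) (sym cWA) (reach-+ {l = l} {l′} 1≤b b+2≤s r r′)
    where
    add : ∀ {i j m} p q → i ≤ j + m → j + k + l ≤ 2 * p → m + k′ + l′ ≤ 2 * q → i + (k + k′) + (l + l′) ≤ 2 * (p + q)
    add {i} {j} {m} p q h₁ h₂ h₃ = linear 0 (h₁ ⊕ h₂ ⊕ h₃) (solve (i ∷ j ∷ m ∷ k ∷ k′ ∷ l ∷ l′ ∷ p ∷ q ∷ []))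

  module _ (c : Cut n s) {es} (p : Peel {s = s} es) (av : All (Avoids c) es) {v : Fin n} (v∈B : v ∈ˢ B c) (3≤s : 3 ≤ s) where

    half-cards : ∀ {W W₁ W₂} → (∀ {x} → x ∈ˢ W → x ∈ˢ W₁ ⊎ x ∈ˢ W₂) → Disjoint W₁ W₂ → W₁ ⊆ W → W₂ ⊆ W →
      card (W ∩ A c) ≡ card (W₁ ∩ A c) + card (W₂ ∩ A c)
    half-cards cov dis i j = card-partition
      (λ x → ⊎-map (λ y → ∈∩ y (∈∩ʳ x)) (λ y → ∈∩ y (∈∩ʳ x)) (cov (∈∩ˡ x)))
      (λ x y → dis (∈∩ˡ x) (∈∩ˡ y)) (λ x → ∈∩ (i (∈∩ˡ x)) (∈∩ʳ x)) (λ x → ∈∩ (j (∈∩ˡ x)) (∈∩ʳ x))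

    untouched : ∀ {b W} → v ∉ˢ W → 1 ≤ card W → card (W ∩ A c) ≡ 0 → Priced es c v b W 1
    untouched {W = W} v∉W 1≤W a≡0 = 0 , lower (card W) (enlarge (sparse p) v∉W 1≤W) , ≤-reflexive a≡0
      where
      lower : ∀ {i} w → i + 3 ≤ 2 * suc w → i + 1 + 0 ≤ 2 * w
      lower {i} w h = linear 0 h (solve (i ∷ w ∷ []))

    apex∉A : v ∉ˢ A c
    apex∉A a = A∩B c a v∈B

    apex≢centre : v ≢ centre c
    apex≢centre refl = centre∉B c v∈B

    -- The vertices of `A c` are severed from `v`. A cell that is one such vertex loses 1 against
    -- 2|W| - 1, namely its edge to `v`; any other cell meeting `A c` loses 2, and contributes fewer
    -- than s vertices because of its size.
    priced-∉ : ∀ {W k} → v ∉ˢ W → centre c ∉ˢ W → Cells s es W k → Priced es c v 1 W k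
    priced-∉ v∉W z∉W (node cov dis i j sep f g) = merge {c = c} ≤-refl 3≤s (card-partition cov dis i j) (half-cards cov dis i j)
      (cells-inside cov sep) (priced-∉ (v∉W ∘ i) (z∉W ∘ i) f) (priced-∉ (v∉W ∘ j) (z∉W ∘ j) g)
    priced-∉ {W} v∉W z∉W (cell 1≤W W<s) with zero-or-positive (card (W ∩ A c))
    ... | inj₁ a≡0 = untouched v∉W 1≤W a≡0
    ... | inj₂ 1≤a = cases (≤1-or-≥2 (card (W ∩ A c))) (zero-or-positive (card (W ∩ B c)))
      where
      a b : ℕ
      a = card (W ∩ A c)
      b = card (W ∩ B c)
      split : inside es (W ∪ ⁅ v ⁆) ≤ inside es (W ∩ A c) + inside es ((W ∩ B c) ∪ ⁅ v ⁆)
      split = hinge c av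
        (λ x → [ (λ y → ∈∩ y (∈∩ʳ x)) , (λ y → ⊥-elim (apex∉A (subst (_∈ˢ A c) (∈⁅⁆⁻ y) (∈∩ʳ x)))) ]′ (∈∪⁻ (∈∩ˡ x)))
        (λ x → [ (λ y → ∈∪ˡ (∈∩ y (∈∩ʳ x))) , ∈∪ʳ ]′ (∈∪⁻ (∈∩ˡ x)))
        (λ x → ⊥-elim ([ z∉W , (λ y → apex≢centre (sym (∈⁅⁆⁻ y))) ]′ (∈∪⁻ x)))
      W≡ : card W ≡ a + b
      W≡ = card-centre∉ c z∉W
      a<s : a < s
      a<s = ≤-trans (s≤s (card-mono ∈∩ˡ)) W<s
      alone : b ≡ 0 → inside es (W ∪ ⁅ v ⁆) ≤ inside es (W ∩ A c)
      alone b≡0 = ≤-trans split (≤-reflexive (trans (cong (inside es (W ∩ A c) +_)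
        (inside-single p (≤-reflexive (trans (card-insert (v∉W ∘ ∈∩ˡ)) (cong suc b≡0))))) (+-identityʳ _)))
      W≡a : b ≡ 0 → card W ≡ a
      W≡a b≡0 = trans W≡ (trans (cong (a +_) b≡0) (+-identityʳ a))
      cases : a ≤ 1 ⊎ 2 ≤ a → b ≡ 0 ⊎ 1 ≤ b → Priced es c v 1 W 1
      cases (inj₁ a≤1) (inj₁ b≡0) = 1 , subst (λ m → inside es (W ∪ ⁅ v ⁆) + 1 + 1 ≤ 2 * m) (sym (W≡a b≡0))
          (≤-trans (≤-trans (alone b≡0) (≤-reflexive (inside-single p a≤1)) ⊕ ≤-refl {1} ⊕ ≤-refl {1}) (2 ⊗ 1≤a)) , a≤1
      cases (inj₂ 2≤a) (inj₁ b≡0) = 2 , subst (λ m → inside es (W ∪ ⁅ v ⁆) + 1 + 2 ≤ 2 * m) (sym (W≡a b≡0))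
          (bound a (alone b≡0) (sparse p 2≤a)) , a<s
        where
        bound : ∀ {i j} m → i ≤ j → j + 3 ≤ 2 * m → i + 1 + 2 ≤ 2 * m
        bound {i} {j} m h₁ h₂ = linear 0 (h₁ ⊕ h₂) (solve (i ∷ j ∷ m ∷ []))
      cases _ (inj₂ 1≤b) = 2 , subst (λ m → inside es (W ∪ ⁅ v ⁆) + 1 + 2 ≤ 2 * m) (sym W≡)
          (bound a b split (weaken p (sparse p) 1≤a) (enlarge (sparse p) (v∉W ∘ ∈∩ˡ) 1≤b)) , a<s
        where
        bound : ∀ {i j k} a b → i ≤ j + k → j + 2 ≤ 2 * a → k + 3 ≤ 2 * suc b → i + 1 + 2 ≤ 2 * (a + b)
        bound {i} {j} {k} a b h₁ h₂ h₃ = linear 0 (h₁ ⊕ h₂ ⊕ h₃) (solve (i ∷ j ∷ k ∷ a ∷ b ∷ []))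

    -- The part in `A c` still reaches `v` through the centre, so the loss is only 1. But the centre
    -- takes up a place in its cell of fewer than s vertices, which leaves at most s - 2 for `A c`.
    priced-∈ : ∀ {W k} → v ∉ˢ W → centre c ∈ˢ W → Cells s es W k → Priced es c v (s ∸ 2) W k
    priced-∈ {W} v∉W z∈W (node {W₁ = W₁} {W₂} {k} {l} cov dis i j sep f g) with cov z∈W
    ... | inj₁ z = merge {c = c} (∸-monoˡ-≤ 2 3≤s) (≤-reflexive (m∸n+n≡m (≤-trans (n≤1+n 2) 3≤s)))
      (card-partition cov dis i j) (half-cards cov dis i j)
      (cells-inside cov sep) (priced-∈ (v∉W ∘ i) z f) (priced-∉ (v∉W ∘ j) (dis z) g)
    ... | inj₂ z = subst (Priced es c v (s ∸ 2) W) (+-comm l k)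
      (merge {c = c} (∸-monoˡ-≤ 2 3≤s) (≤-reflexive (m∸n+n≡m (≤-trans (n≤1+n 2) 3≤s)))
      (trans (card-partition cov dis i j) (+-comm (card W₁) _)) (trans (half-cards cov dis i j) (+-comm (card (W₁ ∩ A c)) _))
      (≤-trans (cells-inside cov sep) (≤-reflexive (+-comm (inside es (W₁ ∪ ⁅ v ⁆)) _)))
      (priced-∈ (v∉W ∘ j) z g) (priced-∉ (v∉W ∘ i) (λ y → dis y z) f))
    priced-∈ {W} v∉W z∈W (cell 1≤W W<s) with zero-or-positive (card (W ∩ A c))
    ... | inj₁ a≡0 = untouched v∉W 1≤W a≡0
    ... | inj₂ 1≤a = 1 , subst (λ m → inside es (W ∪ ⁅ v ⁆) + 1 + 1 ≤ 2 * m) (sym W≡)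
        (bound a b split (enlarge (sparse p) (λ x → centre∉A c (∈∩ʳ x)) 1≤a) half) , a≤s-2
      where
      a b : ℕ
      a = card (W ∩ A c)
      b = card (W ∩ B c)
      W≡ : card W ≡ suc (a + b)
      W≡ = card-centre∈ c z∈W
      a≤s-2 : a ≤ s ∸ 2
      a≤s-2 = m+n≤o⇒m≤o∸n a (room W≡ W<s)
        where
        room : ∀ {m} → m ≡ suc (a + b) → m < s → a + 2 ≤ s
        room h₁ h₂ = linear b (≤-reflexive (sym h₁) ⊕ h₂) (eq _ a b)
          where
          eq : ∀ m a b → a + 2 + (m + s) + b ≡ s + (suc (a + b) + suc m)
          eq m a b = solve (m ∷ a ∷ b ∷ s ∷ [])
      split : inside es (W ∪ ⁅ v ⁆) ≤
        inside es ((W ∩ A c) ∪ ⁅ centre c ⁆) + inside es (((W ∩ B c) ∪ ⁅ v ⁆) ∪ ⁅ centre c ⁆)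
      split = hinge c av
        (λ x → [ (λ y → ∈∪ˡ (∈∩ y (∈∩ʳ x))) , (λ y → ⊥-elim (apex∉A (subst (_∈ˢ A c) (∈⁅⁆⁻ y) (∈∩ʳ x)))) ]′ (∈∪⁻ (∈∩ˡ x)))
        (λ x → ∈∪ˡ ([ (λ y → ∈∪ˡ (∈∩ y (∈∩ʳ x))) , ∈∪ʳ ]′ (∈∪⁻ (∈∩ˡ x))))
        (λ _ → ∈∪ʳ ∈⁅⁆ , ∈∪ʳ ∈⁅⁆)
      half : inside es (((W ∩ B c) ∪ ⁅ v ⁆) ∪ ⁅ centre c ⁆) + 3 ≤ 2 * suc (suc b)
      half = subst (λ m → inside es (((W ∩ B c) ∪ ⁅ v ⁆) ∪ ⁅ centre c ⁆) + 3 ≤ 2 * suc m) (card-insert (v∉W ∘ ∈∩ˡ))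
        (enlarge (sparse p)
          (λ x → [ (λ y → centre∉B c (∈∩ʳ y)) , (λ y → apex≢centre (sym (∈⁅⁆⁻ y))) ]′ (∈∪⁻ x))
          (∈⇒card (∈∪ʳ ∈⁅⁆)))
      bound : ∀ {i j k} a b → i ≤ j + k → j + 3 ≤ 2 * suc a → k + 3 ≤ 2 * suc (suc b) → i + 1 + 1 ≤ 2 * suc (a + b)
      bound {i} {j} {k} a b h₁ h₂ h₃ = linear 0 (h₁ ⊕ h₂ ⊕ h₃) (solve (i ∷ j ∷ k ∷ a ∷ b ∷ []))

-- The lower bound

module _ {n s : ℕ} (3≤s : 3 ≤ s) where
  2≤s : 2 ≤ s
  2≤s = ≤-trans (n≤1+n 2) 3≤s

  reach-< : ∀ l {a} → l ≤ 2 → Reach {n} {s} (s ∸ 2) l a → a < s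
  reach-< 0 _ h = ≤-trans (s≤s h) (≤-trans (n≤1+n 1) 2≤s)
  reach-< 1 _ h = ≤-trans (s≤s h) (≤-trans (n≤1+n _) (≤-reflexive (trans (+-comm 2 (s ∸ 2)) (m∸n+n≡m 2≤s))))
  reach-< 2 _ h = h
  reach-< (suc (suc (suc _))) (s≤s (s≤s ())) _

  -- All s vertices of `A c` lie in the cells, as `v` is in `B c`. Reaching s takes a shortfall of
  -- at least 3, while the density allows only 2.
  away-from-centre : ∀ {es} (c : Cut n s) → Peel {s = s} es → All (Avoids c) es →
    ∀ {v k} → v ∈ˢ B c → card (∁ ⁅ v ⁆) ≡ 2 * s → Cells s es (∁ ⁅ v ⁆) k → 4 * s ≤ length es + 2 + k → ⊥
  away-from-centre {es} c p av {v} {k} v∈B W≡2s f dense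
    with priced-∈ c p av v∈B 3≤s (λ x → ∈∁⁻ x ∈⁅⁆) (∈∁ (λ x → centre∉B c (subst (_∈ˢ B c) (sym (∈⁅⁆⁻ x)) v∈B))) f
  ... | l , h , r = <-irrefl refl (≤-trans (s≤s s≤a) (reach-< l (cheap all h W≡2s dense) r))
    where
    all : length es ≤ inside es (∁ ⁅ v ⁆ ∪ ⁅ v ⁆)
    all = ≤-trans (≤-reflexive (sym (inside-full es)))
      (inside-mono (All.tabulate λ _ _ → everything , everything))
      where
      everything : ∀ {x} → x ∈ˢ ∁ ⁅ v ⁆ ∪ ⁅ v ⁆
      everything {x} with x ∈? ⁅ v ⁆
      ... | yes q = ∈∪ʳ q
      ... | no q  = ∈∪ˡ (∈∁ q)
    s≤a : s ≤ card (∁ ⁅ v ⁆ ∩ A c)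
    s≤a = ≤-trans (≤-reflexive (sym (card-A c)))
      (card-mono λ x → ∈∩ (∈∁ λ q → A∩B c x (subst (_∈ˢ B c) (sym (∈⁅⁆⁻ q)) v∈B)) x)
    cheap : ∀ {i j w} → j ≤ i → i + k + l ≤ 2 * w → w ≡ 2 * s → 4 * s ≤ j + 2 + k → l ≤ 2
    cheap {i} {j} h₁ h₂ refl h₃ = linear 0 (h₁ ⊕ h₂ ⊕ h₃) (solve (i ∷ j ∷ k ∷ l ∷ s ∷ []))

  -- A cut centred at `v` costs one edge and gains one cell, so the density survives the induction
  -- step; other cuts are refuted by `away-from-centre`. At the end 4s - 1 cells would have to fit
  -- into 2s vertices.
  petals : ∀ {es} → Peel {s = s} es → ∀ {v k} → card (∁ ⁅ v ⁆) ≡ 2 * s → Cells s es (∁ ⁅ v ⁆) k →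
    4 * s ≤ length es + 1 + k → ⊥
  petals [] {k = k} W≡2s f dense = absurd (few (≤-trans (cells-count f) (≤-reflexive W≡2s)))
    where
    few : k ≤ 2 * s → 1 ≤ 0
    few h = linear 4 (2 ⊗ 3≤s ⊕ dense ⊕ h) (solve (k ∷ s ∷ []))
  petals {e ∷ es} (peel c cr av p) {v} {k} W≡2s f dense with v ≟ centre c
  ... | yes refl = petals p W≡2s (refine c cr av (λ x → ∈∁⁻ x ∈⁅⁆) (ends cr) f)
      (≤-trans dense (≤-reflexive (sym (+-suc (length es + 1) k))))
    where
    off : ∀ {x X} → centre c ∉ˢ X → x ∈ˢ X → x ∈ˢ ∁ ⁅ centre c ⁆
    off {X = X} z∉X p = ∈∁ λ q → z∉X (subst (_∈ˢ X) (∈⁅⁆⁻ q) p)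
    ends : ∀ {e} → Crosses c e → Within (∁ ⁅ centre c ⁆) e
    ends (inj₁ (a , b)) = off (centre∉A c) a , off (centre∉B c) b
    ends (inj₂ (b , a)) = off (centre∉B c) b , off (centre∉A c) a
  ... | no v≢z with trichotomy c v
  ...   | inj₁ v≡z = v≢z v≡z
  ...   | inj₂ (inj₂ b) = away-from-centre c p av b W≡2s (cells-tail f) dense′
    where
    dense′ : 4 * s ≤ length es + 2 + k
    dense′ = ≤-trans dense (≤-reflexive (cong (_+ k) (sym (+-suc (length es) 1))))
  ...   | inj₂ (inj₁ a) = away-from-centre (flip c) p (flip-Avoids {c = c} av) a W≡2s (cells-tail f) dense′
    where
    dense′ : 4 * s ≤ length es + 2 + k
    dense′ = ≤-trans dense (≤-reflexive (cong (_+ k) (sym (+-suc (length es) 1))))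

  card-∩-comm : ∀ (X Y : VSet n) → card (X ∩ Y) ≡ card (Y ∩ X)
  card-∩-comm X Y = card-≡ (λ p → ∈∩ (∈∩ʳ p) (∈∩ˡ p)) (λ p → ∈∩ (∈∩ʳ p) (∈∩ˡ p))

  module _ {es} (p : Peel {n} {s} es) (dense : 4 * s ≤ length es + 5) where

    -- As e crosses d but not c, each class of c meets each class of d: four cells around the centre.
    concentric : ∀ {e} (c d : Cut n s) → centre c ≡ centre d → Avoids c e → Crosses d e →
      All (Avoids c) es → All (Avoids d) es → ⊥
    concentric {e} c d refl avoid cross avc avd = petals p W≡2s four
        (≤-trans dense (≤-reflexive (sym (+-assoc (length es) 1 4))))
      where
      v : Fin n
      v = centre c
      W : VSet n
      W = ∁ ⁅ v ⁆
      v∉W : v ∉ˢ W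
      v∉W x = ∈∁⁻ x ∈⁅⁆
      off : ∀ {x X} → v ∉ˢ X → x ∈ˢ X → x ∈ˢ W
      off {X = X} z∉X p = ∈∁ λ q → z∉X (subst (_∈ˢ X) (∈⁅⁆⁻ q) p)
      W≡2s : card W ≡ 2 * s
      W≡2s = trans (card-centre∉ c v∉W) (cong₂ _+_
        (trans (card-≡ ∈∩ʳ λ x → ∈∩ (off (centre∉A c) x) x) (card-A c))
        (trans (card-≡ ∈∩ʳ λ x → ∈∩ (off (centre∉B c) x) x) (trans (card-B c) (sym (+-identityʳ s)))))
      -- Were the two classes disjoint, `A c′` would be `B d′` by size; the cuts would then agree up
      -- to a flip, and `e` would cross both.
      meet : ∀ (c′ d′ : Cut n s) → centre c′ ≡ v → centre d′ ≡ v → ¬ Crosses c′ e → Crosses d′ e →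
        1 ≤ card ((W ∩ A c′) ∩ A d′)
      meet c′ d′ c≡ d≡ avoid cross with zero-or-positive (card ((W ∩ A c′) ∩ A d′))
      ... | inj₂ q = q
      ... | inj₁ q = ⊥-elim (avoid (transfer cross))
        where
        A⊆B : A c′ ⊆ B d′
        A⊆B {x} a with trichotomy d′ x
        ... | inj₁ refl     = ⊥-elim (centre∉A c′ (subst (_∈ˢ A c′) (trans d≡ (sym c≡)) a))
        ... | inj₂ (inj₁ b) = ⊥-elim (card-∅ q (∈∩ (∈∩ (off (subst (_∉ˢ A c′) c≡ (centre∉A c′)) a) a) b))
        ... | inj₂ (inj₂ b) = b
        B⊆A : B d′ ⊆ A c′
        B⊆A = ⊆-card⇒⊇ A⊆B (≤-reflexive (trans (card-B d′) (sym (card-A c′))))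
        A⊆B′ : A d′ ⊆ B c′
        A⊆B′ {x} a with trichotomy c′ x
        ... | inj₁ refl     = ⊥-elim (centre∉A d′ (subst (_∈ˢ A d′) (trans c≡ (sym d≡)) a))
        ... | inj₂ (inj₁ b) = ⊥-elim (A∩B d′ a (A⊆B b))
        ... | inj₂ (inj₂ b) = b
        transfer : ∀ {e} → Crosses d′ e → Crosses c′ e
        transfer (inj₁ (a , b)) = inj₂ (A⊆B′ a , B⊆A b)
        transfer (inj₂ (b , a)) = inj₁ (B⊆A b , A⊆B′ a)
      small : ∀ {X Y Z : VSet n} → Disjoint Y Z → card X ≡ s → 1 ≤ card ((W ∩ X) ∩ Z) → card ((W ∩ X) ∩ Y) < s
      small {X} {Y} {Z} dis sX 1≤Z = ≤-trans (≤-trans (≤-reflexive (+-comm 1 _)) (≤-refl {card ((W ∩ X) ∩ Y)} ⊕ 1≤Z))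
        (subst (card ((W ∩ X) ∩ Y) + card ((W ∩ X) ∩ Z) ≤_) sX
          (card-disjoint (λ y z → dis (∈∩ʳ y) (∈∩ʳ z)) (λ y → ∈∩ʳ (∈∩ˡ y)) (λ y → ∈∩ʳ (∈∩ˡ y))))
      AA : 1 ≤ card ((W ∩ A c) ∩ A d)
      AA = meet c d refl refl avoid cross
      AB : 1 ≤ card ((W ∩ A c) ∩ B d)
      AB = meet c (flip d) refl refl avoid (⊎-swap cross)
      BA : 1 ≤ card ((W ∩ B c) ∩ A d)
      BA = meet (flip c) d refl refl (avoid ∘ ⊎-swap) cross
      BB : 1 ≤ card ((W ∩ B c) ∩ B d)
      BB = meet (flip c) (flip d) refl refl (avoid ∘ ⊎-swap) (⊎-swap cross)
      swapped : Disjoint (B d) (A d)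
      swapped b a = A∩B d a b
      four : Cells s es W 4
      four = cut-node c avc v∉W
        (cut-node d avd (v∉W ∘ ∈∩ˡ) (cell AA (small (A∩B d) (card-A c) AB)) (cell AB (small swapped (card-A c) AA)))
        (cut-node d avd (v∉W ∘ ∈∩ˡ) (cell BA (small (A∩B d) (card-B c) BB)) (cell BB (small swapped (card-B c) BA)))

    -- T = A c contains the centre of d, and U = B c; aT, bT, aU, bU are the sizes of their traces on A d, B d.
    crossing-cuts : ∀ (c d : Cut n s) → centre c ∈ˢ B d → centre d ∈ˢ A c →
      All (Avoids c) es → All (Avoids d) es → ⊥
    crossing-cuts c d v∈B z∈A avc avd = cases (zero-or-positive aT) (≤1-or-≥2 aU)
      where
      v z : Fin n
      v = centre c
      z = centre d
      v∉A : v ∉ˢ A d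
      v∉A a = A∩B d a v∈B
      z∉B : z ∉ˢ B c
      z∉B = A∩B c z∈A
      v≢z : v ≢ z
      v≢z eq = centre∉B d (subst (_∈ˢ B d) eq v∈B)
      aT bT aU bU : ℕ
      aT = card (A c ∩ A d)
      bT = card (A c ∩ B d)
      aU = card (B c ∩ A d)
      bU = card (B c ∩ B d)
      T≡ : s ≡ suc (aT + bT)
      T≡ = trans (sym (card-A c)) (card-centre∈ d z∈A)
      U≡ : s ≡ aU + bU
      U≡ = trans (sym (card-B c)) (card-centre∉ d z∉B)
      A≡ : s ≡ aT + aU
      A≡ = trans (trans (sym (card-A d)) (card-centre∉ c v∉A)) (cong₂ _+_ (card-∩-comm _ _) (card-∩-comm _ _))
      whole : length es ≤ inside es (A c ∪ ⁅ v ⁆) + inside es (B c ∪ ⁅ v ⁆)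
      whole = ≤-trans (≤-reflexive (sym (inside-full es)))
        (hinge c avc (λ x → ∈∪ˡ (∈∩ʳ x)) (λ x → ∈∪ˡ (∈∩ʳ x)) (λ _ → ∈∪ʳ ∈⁅⁆ , ∈∪ʳ ∈⁅⁆))
      v-off : ∀ {X x} → x ∈ˢ (X ∪ ⁅ v ⁆) ∩ A d → x ∈ˢ X
      v-off x = [ id , (λ y → ⊥-elim (v∉A (subst (_∈ˢ A d) (∈⁅⁆⁻ y) (∈∩ʳ x)))) ]′ (∈∪⁻ (∈∩ˡ x))
      z∉ : z ∉ˢ B c ∪ ⁅ v ⁆
      z∉ x = [ z∉B , (λ y → v≢z (sym (∈⁅⁆⁻ y))) ]′ (∈∪⁻ x)

      -- `A d` is then all of `B c`: `c` forbids edges from it to `A c`, and `d` forbids edges from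
      -- it to `v`.
      nested : aT ≡ 0 → ⊥
      nested aT≡0 = detached-pair 3≤s dis (card-B c) (trans (card-insert (centre∉A c)) (cong suc (card-A c)))
          p cover (All.zipWith (λ (g , h) → edge g h) (avc , avd)) dense
        where
        A⊆B : A d ⊆ B c
        A⊆B {x} a with trichotomy c x
        ... | inj₁ refl     = ⊥-elim (v∉A a)
        ... | inj₂ (inj₁ t) = ⊥-elim (card-∅ aT≡0 (∈∩ t a))
        ... | inj₂ (inj₂ u) = u
        B⊆A : B c ⊆ A d
        B⊆A = ⊆-card⇒⊇ A⊆B (≤-reflexive (trans (card-B c) (sym (card-A d))))
        dis : Disjoint (B c) (A c ∪ ⁅ v ⁆)
        dis b x = [ (λ a → A∩B c a b) , (λ y → centre∉B c (subst (_∈ˢ B c) (∈⁅⁆⁻ y) b)) ]′ (∈∪⁻ x)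
        cover : ∀ x → x ∈ˢ B c ⊎ x ∈ˢ A c ∪ ⁅ v ⁆
        cover x with trichotomy c x
        ... | inj₁ refl     = inj₂ (∈∪ʳ ∈⁅⁆)
        ... | inj₂ (inj₁ a) = inj₂ (∈∪ˡ a)
        ... | inj₂ (inj₂ b) = inj₁ b
        v∈ : ∀ {x} → x ∈ˢ ⁅ v ⁆ → x ∈ˢ B d
        v∈ y = subst (_∈ˢ B d) (sym (∈⁅⁆⁻ y)) v∈B
        edge : ∀ {e} → Avoids c e → Avoids d e → Within (B c) e ⊎ Within (A c ∪ ⁅ v ⁆) e
        edge {x , y} g h with cover x | cover y
        ... | inj₁ a | inj₁ b = inj₁ (a , b)
        ... | inj₂ a | inj₂ b = inj₂ (a , b)
        ... | inj₁ a | inj₂ b = ⊥-elim ([ (λ t → g (inj₂ (a , t))) , (λ t → h (inj₁ (B⊆A a , v∈ t))) ]′ (∈∪⁻ b))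
        ... | inj₂ a | inj₁ b = ⊥-elim ([ (λ t → g (inj₁ (t , b))) , (λ t → h (inj₂ (v∈ t , B⊆A b))) ]′ (∈∪⁻ a))

      -- Counting gives bT + 1 = aU, so `bT` vanishes and `A c`, `B d` are disjoint. Apart from
      -- their edges only the one between `v` and `z` can remain, so there are at most 2(2s - 3) +
      -- 1. `dense` asks for that many, hence both sets are rigid.
      tight : aU ≤ 1 → ⊥
      tight aU≤1 = rigid-pair p 3≤s dis (card-A c) (card-B d)
          (rigid₁ whole left right rest (bound (card-A c)) (bound (card-B d)) dense)
          (rigid₂ whole left right rest (bound (card-A c)) (bound (card-B d)) dense)
        where
        bT≡0 : bT ≡ 0
        bT≡0 = n≤0⇒n≡0 (none T≡ A≡ aU≤1)
          where
          none : s ≡ suc (aT + bT) → s ≡ aT + aU → aU ≤ 1 → bT ≤ 0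
          none h₁ h₂ h₃ = linear 0 (≤-reflexive (trans (sym h₁) h₂) ⊕ h₃) (eq aT bT aU)
            where
            eq : ∀ x y z → y + (x + z + 1) + 0 ≡ 0 + (suc (x + y) + z)
            eq x y z = solve (x ∷ y ∷ z ∷ [])
        dis : Disjoint (A c) (B d)
        dis a b = card-∅ bT≡0 (∈∩ a b)
        right : inside es (B c ∪ ⁅ v ⁆) ≤ inside es (B d)
        right = subst (λ m → inside es (B c ∪ ⁅ v ⁆) ≤ m + inside es (B d)) (inside-single p aU≤1)
          (hinge d {Y = B c ∩ A d} avd (λ x → ∈∩ (v-off x) (∈∩ʳ x)) ∈∩ʳ (λ x → ⊥-elim (z∉ x)))
        left : inside es (A c ∪ ⁅ v ⁆) ≤ inside es (A c) + inside es (⁅ v ⁆ ∪ ⁅ z ⁆)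
        left = hinge d avd v-off
          (λ x → [ (λ a → ⊥-elim (dis a (∈∩ʳ x))) , ∈∪ˡ ]′ (∈∪⁻ (∈∩ˡ x))) (λ _ → z∈A , ∈∪ʳ ∈⁅⁆)
        pair : card (⁅ v ⁆ ∪ ⁅ z ⁆) ≡ 2
        pair = trans (card-insert (λ x → v≢z (sym (∈⁅⁆⁻ x)))) (cong suc (card-⁅⁆ v))
        rest : inside es (⁅ v ⁆ ∪ ⁅ z ⁆) + 3 ≤ 4
        rest = subst (λ k → inside es (⁅ v ⁆ ∪ ⁅ z ⁆) + 3 ≤ 2 * k) pair (sparse p (≤-reflexive (sym pair)))
        bound : ∀ {X} → card X ≡ s → inside es X + 3 ≤ 2 * s
        bound {X} sX = subst (λ k → inside es X + 3 ≤ 2 * k) sX (sparse p (subst (2 ≤_) (sym sX) 2≤s))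
        rigid₁ : ∀ {l′ f g i j k} → l′ ≤ f + g → f ≤ i + k → g ≤ j → k + 3 ≤ 4 → i + 3 ≤ 2 * s → j + 3 ≤ 2 * s → 4 * s ≤ l′ + 5 → 2 * s ≤ i + 3
        rigid₁ {l′} {f} {g} {i} {j} {k} h₁ h₂ h₃ h₄ _ h₆ h₇ =
          linear 0 (h₁ ⊕ h₂ ⊕ h₃ ⊕ h₄ ⊕ h₆ ⊕ h₇) (solve (l′ ∷ f ∷ g ∷ i ∷ j ∷ k ∷ s ∷ []))
        rigid₂ : ∀ {l′ f g i j k} → l′ ≤ f + g → f ≤ i + k → g ≤ j → k + 3 ≤ 4 → i + 3 ≤ 2 * s → j + 3 ≤ 2 * s → 4 * s ≤ l′ + 5 → 2 * s ≤ j + 3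
        rigid₂ {l′} {f} {g} {i} {j} {k} h₁ h₂ h₃ h₄ h₅ _ h₇ =
          linear 0 (h₁ ⊕ h₂ ⊕ h₃ ⊕ h₄ ⊕ h₅ ⊕ h₇) (solve (l′ ∷ f ∷ g ∷ i ∷ j ∷ k ∷ s ∷ []))

      -- The four parts carry at most 2(aT + 1) - 3, 2(bT + 2) - 3, 2aU - 3 and 2(bU + 1) - 3 edges,
      -- in total 4s - 6, one less than `dense` requires.
      generic : 1 ≤ aT → 2 ≤ aU → ⊥
      generic 1≤aT 2≤aU = absurd (clash aT bT aU bU whole left right
          (enlarge (sparse p) (λ x → centre∉A d (∈∩ʳ x)) 1≤aT) half (sparse p 2≤aU)
          (enlarge (sparse p) (λ x → centre∉B c (∈∩ˡ x)) (subst (1 ≤_) aT≡bU 1≤aT)) T≡ U≡ dense)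
        where
        aT≡bU : aT ≡ bU
        aT≡bU = +-cancelˡ-≡ aU aT bU (trans (+-comm aU aT) (trans (sym A≡) U≡))
        right : inside es (B c ∪ ⁅ v ⁆) ≤ inside es (B c ∩ A d) + inside es ((B c ∩ B d) ∪ ⁅ v ⁆)
        right = hinge d avd (λ x → ∈∩ (v-off x) (∈∩ʳ x))
          (λ x → [ (λ y → ∈∪ˡ (∈∩ y (∈∩ʳ x))) , ∈∪ʳ ]′ (∈∪⁻ (∈∩ˡ x))) (λ x → ⊥-elim (z∉ x))
        left : inside es (A c ∪ ⁅ v ⁆) ≤ inside es ((A c ∩ A d) ∪ ⁅ z ⁆) + inside es (((A c ∩ B d) ∪ ⁅ v ⁆) ∪ ⁅ z ⁆)
        left = hinge d avd (λ x → ∈∪ˡ (∈∩ (v-off x) (∈∩ʳ x)))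
          (λ x → ∈∪ˡ ([ (λ y → ∈∪ˡ (∈∩ y (∈∩ʳ x))) , ∈∪ʳ ]′ (∈∪⁻ (∈∩ˡ x)))) (λ _ → ∈∪ʳ ∈⁅⁆ , ∈∪ʳ ∈⁅⁆)
        half : inside es (((A c ∩ B d) ∪ ⁅ v ⁆) ∪ ⁅ z ⁆) + 3 ≤ 2 * suc (suc bT)
        half = subst (λ m → inside es (((A c ∩ B d) ∪ ⁅ v ⁆) ∪ ⁅ z ⁆) + 3 ≤ 2 * suc m) (card-insert (λ x → centre∉A c (∈∩ˡ x)))
          (enlarge (sparse p)
            (λ x → [ (λ y → centre∉B d (∈∩ʳ y)) , (λ y → v≢z (sym (∈⁅⁆⁻ y))) ]′ (∈∪⁻ x))
            (∈⇒card (∈∪ʳ ∈⁅⁆)))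
        clash : ∀ {L f g i j k m} aT bT aU bU → L ≤ f + g → f ≤ i + j → g ≤ k + m →
          i + 3 ≤ 2 * suc aT → j + 3 ≤ 2 * suc (suc bT) → k + 3 ≤ 2 * aU → m + 3 ≤ 2 * suc bU →
          s ≡ suc (aT + bT) → s ≡ aU + bU → 4 * s ≤ L + 5 → 1 ≤ 0
        clash {L} {f} {g} {i} {j} {k} {m} aT bT aU bU h₁ h₂ h₃ h₄ h₅ h₆ h₇ h₈ h₉ h₀ =
          linear 0 (h₁ ⊕ h₂ ⊕ h₃ ⊕ h₄ ⊕ h₅ ⊕ h₆ ⊕ h₇ ⊕ 2 ⊗ ≤-reflexive (sym h₈) ⊕ 2 ⊗ ≤-reflexive (sym h₉) ⊕ h₀)
            (solve (L ∷ f ∷ g ∷ i ∷ j ∷ k ∷ m ∷ aT ∷ bT ∷ aU ∷ bU ∷ s ∷ []))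

      cases : aT ≡ 0 ⊎ 1 ≤ aT → aU ≤ 1 ⊎ 2 ≤ aU → ⊥
      cases (inj₁ aT≡0) _        = nested aT≡0
      cases (inj₂ _) (inj₁ aU≤1) = tight aU≤1
      cases (inj₂ 1≤aT) (inj₂ 2≤aU) = generic 1≤aT 2≤aU

  -- Taking off two edges leaves at least 4s - 5. If the centres of their cuts differ, flips bring
  -- them into the position that `crossing-cuts` expects.
  too-dense : ∀ {es} → Peel {n} {s} es → 4 * s < length es + 4 → ⊥
  too-dense [] h = absurd (linear 8 (4 ⊗ 3≤s ⊕ h) (solve (s ∷ [])))
  too-dense (peel _ _ _ []) h = absurd (linear 7 (4 ⊗ 3≤s ⊕ h) (solve (s ∷ [])))
  too-dense (peel {es = _ ∷ es} c _ (a ∷ᴬ avc) (peel d cr avd p)) h = cases (centre c ≟ centre d)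
    where
    dense : 4 * s ≤ length es + 5
    dense = ≤-trans (≤-pred h) (≤-reflexive (sym (+-suc (length es) 4)))
    avc′ : All (Avoids (flip c)) es
    avc′ = flip-Avoids {c = c} avc
    avd′ : All (Avoids (flip d)) es
    avd′ = flip-Avoids {c = d} avd
    cases : Dec (centre c ≡ centre d) → ⊥
    cases (yes eq) = concentric p dense c d eq a cr avc avd
    cases (no neq) with trichotomy d (centre c) | trichotomy c (centre d)
    ... | inj₁ eq | _ = neq eq
    ... | inj₂ _ | inj₁ eq = neq (sym eq)
    ... | inj₂ (inj₁ i) | inj₂ (inj₁ j) = crossing-cuts p dense c (flip d) i j avc avd′
    ... | inj₂ (inj₁ i) | inj₂ (inj₂ j) = crossing-cuts p dense (flip c) (flip d) i j avc′ avd′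
    ... | inj₂ (inj₂ i) | inj₂ (inj₁ j) = crossing-cuts p dense c d i j avc avd
    ... | inj₂ (inj₂ i) | inj₂ (inj₂ j) = crossing-cuts p dense (flip c) d i j avc′ avd

  peel-length : ∀ {es} → Peel {n} {s} es → length es + 4 ≤ 4 * s
  peel-length p = ≮⇒≥ (too-dense p)

-- Copies of K_{s,s} as balanced cuts

image : ∀ {n s} → (Fin s → Fin n) → VSet n
image {s = zero}  g = ∁ full
image {s = suc s} g = image (g ∘ suc) ∪ ⁅ g zero ⁆

∈image : ∀ {n s} (g : Fin s → Fin n) i → g i ∈ˢ image g
∈image g zero    = ∈∪ʳ ∈⁅⁆
∈image g (suc i) = ∈∪ˡ (∈image (g ∘ suc) i)

∈image⁻ : ∀ {n s} (g : Fin s → Fin n) {x} → x ∈ˢ image g → ∃ λ i → g i ≡ x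
∈image⁻ {s = zero}  g p = ⊥-elim (∈∁⁻ p ∈full)
∈image⁻ {s = suc s} g p with ∈∪⁻ p
... | inj₂ q = zero , sym (∈⁅⁆⁻ q)
... | inj₁ q with ∈image⁻ (g ∘ suc) q
...   | i , eq = suc i , eq

card-image : ∀ {n s} (g : Fin s → Fin n) → Injective _≡_ _≡_ g → card (image g) ≡ s
card-image {s = zero}  g inj = card-empty (λ p → ∈∁⁻ p ∈full)
card-image {s = suc s} g inj = trans (card-insert fresh) (cong suc (card-image (g ∘ suc) (λ eq → suc-injective (inj eq))))
  where
  fresh : g zero ∉ˢ image (g ∘ suc)
  fresh p with ∈image⁻ (g ∘ suc) p
  ... | i , eq with inj eq
  ...   | ()

enumerate : ∀ {n} s (X : VSet n) → card X ≡ s →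
  ∃ λ (g : Fin s → Fin n) → Injective _≡_ _≡_ g × (∀ i → g i ∈ˢ X) × (∀ {x} → x ∈ˢ X → ∃ λ i → g i ≡ x)
enumerate zero X c = (λ ()) , (λ { {()} }) , (λ ()) , λ p → ⊥-elim (card-∅ c p)
enumerate {n} (suc s) X c with inhabited (≤-trans (s≤s z≤n) (≤-reflexive (sym c)))
... | x , x∈X with enumerate s (X ∩ ∁ ⁅ x ⁆) smaller
  where
  smaller : card (X ∩ ∁ ⁅ x ⁆) ≡ s
  smaller = +-cancelˡ-≡ 1 _ _ (trans (cong (_+ card (X ∩ ∁ ⁅ x ⁆)) (sym (card-⁅⁆ x))) (trans (sym (card-partition
    (λ {y} p → [ inj₁ , (λ q → inj₂ (∈∩ p q)) ]′ (either y)) (λ p q → ∈∁⁻ (∈∩ʳ q) p) (⁅⁆⊆ x∈X) ∈∩ˡ)) c))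
    where
    either : ∀ y → y ∈ˢ ⁅ x ⁆ ⊎ y ∈ˢ ∁ ⁅ x ⁆
    either y with y ∈? ⁅ x ⁆
    ... | yes p = inj₁ p
    ... | no p  = inj₂ (∈∁ p)
... | g , inj , into , onto = g′ , inj′ , into′ , onto′
  where
  g′ : Fin (suc s) → Fin n
  g′ zero    = x
  g′ (suc i) = g i
  g≢x : ∀ i → g i ≢ x
  g≢x i eq = ∈∁⁻ (∈∩ʳ (into i)) (subst (_∈ˢ ⁅ x ⁆) (sym eq) ∈⁅⁆)
  inj′ : Injective _≡_ _≡_ g′
  inj′ {zero}  {zero}  eq = refl
  inj′ {zero}  {suc j} eq = ⊥-elim (g≢x j (sym eq))
  inj′ {suc i} {zero}  eq = ⊥-elim (g≢x i eq)
  inj′ {suc i} {suc j} eq = cong suc (inj eq)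
  into′ : ∀ i → g′ i ∈ˢ X
  into′ zero    = x∈X
  into′ (suc i) = ∈∩ˡ (into i)
  onto′ : ∀ {y} → y ∈ˢ X → ∃ λ i → g′ i ≡ y
  onto′ {y} p with y ∈? ⁅ x ⁆
  ... | yes q = zero , sym (∈⁅⁆⁻ q)
  ... | no q with onto (∈∩ p (∈∁ q))
  ...   | i , eq = suc i , eq

card-∁ : ∀ {n} (X : VSet n) → card X + card (∁ X) ≡ n
card-∁ {n} X = trans (sym (card-partition {X = full} cover (λ p q → ∈∁⁻ q p) (λ _ → ∈full) (λ _ → ∈full))) (card-full n)
  where
  cover : ∀ {x} → x ∈ˢ full → x ∈ˢ X ⊎ x ∈ˢ ∁ X
  cover {x} _ with x ∈? X
  ... | yes p = inj₁ p
  ... | no p  = inj₂ (∈∁ p)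

module _ {n s : ℕ} (n≡ : n ≡ 2 * s + 1) where
  -- Of 2s + 1 vertices the two classes leave exactly one, which becomes the centre. The equations
  -- allow later matching on `refl`.
  classes-cut : ∀ {A B : VSet n} → Disjoint A B → card A ≡ s → card B ≡ s →
    ∃ λ (c : Cut n s) → Cut.A c ≡ A × Cut.B c ≡ B
  classes-cut {A} {B} dis sA sB = record
    { A          = A
    ; B          = B
    ; centre     = v
    ; trichotomy = tri
    ; A∩B        = dis
    ; centre∉A   = λ p → ∈∁⁻ v∈C (∈∪ˡ p)
    ; centre∉B   = λ p → ∈∁⁻ v∈C (∈∪ʳ p)
    ; card-A     = sA
    ; card-B     = sB
    } , refl , refl
    where
    C : VSet n
    C = ∁ (A ∪ B)
    C≡1 : card C ≡ 1
    C≡1 = +-cancelˡ-≡ (2 * s) _ _ (trans (cong (_+ card C) (trans (eq sA sB) (sym (card-partition ∈∪⁻ dis ∈∪ˡ ∈∪ʳ))))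
      (trans (card-∁ (A ∪ B)) n≡))
      where
      eq : ∀ {a b} → a ≡ s → b ≡ s → 2 * s ≡ a + b
      eq refl refl = cong (s +_) (+-identityʳ s)
    v : Fin n
    v = proj₁ (inhabited (≤-reflexive (sym C≡1)))
    v∈C : v ∈ˢ C
    v∈C = proj₂ (inhabited (≤-reflexive (sym C≡1)))
    tri : ∀ x → x ≡ v ⊎ x ∈ˢ A ⊎ x ∈ˢ B
    tri x with x ∈? A | x ∈? B | x ≟ v
    ... | yes a | _     | _      = inj₂ (inj₁ a)
    ... | no _  | yes b | _      = inj₂ (inj₂ b)
    ... | no _  | no _  | yes eq = inj₁ eq
    ... | no a  | no b  | no neq = absurd (≤-pred (subst (2 ≤_) C≡1
            (card-pair neq (∈∁ (λ p → [ a , b ]′ (∈∪⁻ p))) v∈C)))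

  class-cut : ∀ {A : VSet n} {v} → v ∉ˢ A → card A ≡ s → Cut n s
  class-cut {A} {v} v∉A sA = record
    { A          = A
    ; B          = ∁ (A ∪ ⁅ v ⁆)
    ; centre     = v
    ; trichotomy = tri
    ; A∩B        = λ a b → ∈∁⁻ b (∈∪ˡ a)
    ; centre∉A   = v∉A
    ; centre∉B   = λ b → ∈∁⁻ b (∈∪ʳ ∈⁅⁆)
    ; card-A     = sA
    ; card-B     = +-cancelˡ-≡ (suc s) _ _ (trans (cong (_+ card (∁ (A ∪ ⁅ v ⁆))) (sym (trans (card-insert v∉A) (cong suc sA))))
                     (trans (card-∁ (A ∪ ⁅ v ⁆)) (trans n≡ (solve (s ∷ [])))))
    }
    where
    tri : ∀ x → x ≡ v ⊎ x ∈ˢ A ⊎ x ∈ˢ ∁ (A ∪ ⁅ v ⁆)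
    tri x with x ∈? A | x ≟ v
    ... | yes a | _      = inj₂ (inj₁ a)
    ... | no _  | yes eq = inj₁ eq
    ... | no a  | no neq = inj₂ (inj₂ (∈∁ (λ p → [ a , (λ q → neq (∈⁅⁆⁻ q)) ]′ (∈∪⁻ p))))

  -- Both orientations, because an edge may cross a cut from either side while a copy only joins `A`
  -- to `B`.
  Absent : Graph n → Edge n → Set
  Absent G (x , y) = G x y ≡ false × G y x ≡ false

  copy-cut : ∀ {G : Graph n} {f} → IsCopyKst s s G f →
    ∃ λ (c : Cut n s) → (∀ a b → f (inj₁ a) ∈ˢ A c × f (inj₂ b) ∈ˢ B c) × (∀ {e} → Absent G e → Avoids c e)
  copy-cut {G} {f} (inj , complete)
    with classes-cut dis (card-image (f ∘ inj₁) (λ eq → inj₁-injective (inj eq))) (card-image (f ∘ inj₂) (λ eq → inj₂-injective (inj eq)))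
    where
    dis : Disjoint (image (f ∘ inj₁)) (image (f ∘ inj₂))
    dis p q with ∈image⁻ (f ∘ inj₁) p | ∈image⁻ (f ∘ inj₂) q
    ... | i , eq | j , eq′ with inj (trans eq (sym eq′))
    ...   | ()
  ... | c , refl , refl = c , (λ a b → ∈image (f ∘ inj₁) a , ∈image (f ∘ inj₂) b) , avoid
    where
    joined : ∀ {x y} → x ∈ˢ image (f ∘ inj₁) → y ∈ˢ image (f ∘ inj₂) → G x y ≡ true
    joined p q with ∈image⁻ (f ∘ inj₁) p | ∈image⁻ (f ∘ inj₂) q
    ... | i , refl | j , refl = complete i j
    avoid : ∀ {e} → Absent G e → ¬ Crosses c e
    avoid (g , h) (inj₁ (a , b)) = conflict (joined a b) g
    avoid (g , h) (inj₂ (b , a)) = conflict (joined a b) h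

  cut-copy : ∀ {G : Graph n} (c : Cut n s) → (∀ {x y} → x ∈ˢ A c → y ∈ˢ B c → G x y ≡ true) →
    ∃ λ f → IsCopyKst s s G f × (∀ {x y} → Crosses c (x , y) →
      ∃ λ a → ∃ λ b → (f (inj₁ a) ≡ x × f (inj₂ b) ≡ y) ⊎ (f (inj₁ a) ≡ y × f (inj₂ b) ≡ x))
  cut-copy {G} c joined with enumerate s (A c) (card-A c) | enumerate s (B c) (card-B c)
  ... | g , g-inj , g-into , g-onto | h , h-inj , h-into , h-onto =
    [ g , h ]′ , (inj , λ a b → joined (g-into a) (h-into b)) , through
    where
    inj : Injective _≡_ _≡_ [ g , h ]′
    inj {inj₁ i} {inj₁ j} eq = cong inj₁ (g-inj eq)
    inj {inj₂ i} {inj₂ j} eq = cong inj₂ (h-inj eq)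
    inj {inj₁ i} {inj₂ j} eq = ⊥-elim (A∩B c (g-into i) (subst (_∈ˢ B c) (sym eq) (h-into j)))
    inj {inj₂ i} {inj₁ j} eq = ⊥-elim (A∩B c (g-into j) (subst (_∈ˢ B c) eq (h-into i)))
    through : ∀ {x y} → Crosses c (x , y) →
      ∃ λ a → ∃ λ b → (g a ≡ x × h b ≡ y) ⊎ (g a ≡ y × h b ≡ x)
    through (inj₁ (p , q)) with g-onto p | h-onto q
    ... | a , eq | b , eq′ = a , b , inj₁ (eq , eq′)
    through (inj₂ (q , p)) with g-onto p | h-onto q
    ... | a , eq | b , eq′ = a , b , inj₂ (eq , eq′)

  Ordered : Edge n → Set
  Ordered (x , y) = toℕ x < toℕ y

  neither : ∀ {P Q : Set} (p? : Dec P) (q? : Dec Q) → ¬ (P × Q) → ⌊ p? ⌋ ∧ ⌊ q? ⌋ ≡ false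
  neither (yes p) (yes q) h = ⊥-elim (h (p , q))
  neither (yes _) (no _)  _ = refl
  neither (no _)  _       _ = refl

  -- Being increasing, two distinct pairs are not reversals of each other either.
  addEdge-absent : ∀ {G : Graph n} {u v e} → Ordered (u , v) → Ordered e → (u , v) ≢ e →
    Absent G e → Absent (addEdge G u v) e
  addEdge-absent {G} {u} {v} {x , y} uv xy neq (p , q) = absent p same reverse , absent q (reverse ∘ swap) (same ∘ swap)
    where
    same : ¬ (x ≡ u × y ≡ v)
    same (refl , refl) = neq refl
    reverse : ¬ (x ≡ v × y ≡ u)
    reverse (refl , refl) = <-asym uv xy
    absent : ∀ {i j} → G i j ≡ false → ¬ (i ≡ u × j ≡ v) → ¬ (i ≡ v × j ≡ u) → addEdge G u v i j ≡ false
    absent {i} {j} g h h′ = cong₂ _∨_ g (cong₂ _∨_ (neither (i ≟ u) (j ≟ v) h) (neither (i ≟ v) (j ≟ u) h′))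

  -- The copy through the first edge sits in the graph from which the later edges are still absent,
  -- so none of them crosses its cut.
  valid-peel : ∀ {G : Graph n} {es} → Unique es → All Ordered es → All (Absent G) es → ValidSequence s s G es → Peel {n} {s} es
  valid-peel {es = []} _ _ _ _ = []
  valid-peel {G} {(u , v) ∷ es} (fresh ∷ᴾ uniq) (o ∷ᴬ os) (_ ∷ᴬ as) ((f , copy , a , b , ends) , valid)
    with copy-cut {addEdge G u v} copy
  ... | c , classes , avoid = peel c (crosses ends) (All.map avoid absent) (valid-peel uniq os absent valid)
    where
    absent : All (Absent (addEdge G u v)) es
    absent = All.zipWith (λ ((neq , o′) , g) → addEdge-absent {G} o o′ neq g) (All.zip (fresh , os) , as)
    crosses : (f (inj₁ a) ≡ u × f (inj₂ b) ≡ v) ⊎ (f (inj₁ a) ≡ v × f (inj₂ b) ≡ u) → Crosses c (u , v)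
    crosses (inj₁ (refl , refl)) = inj₁ (classes a b)
    crosses (inj₂ (refl , refl)) = inj₂ (proj₂ (classes a b) , proj₁ (classes a b))

  both : ∀ {P Q : Set} (p? : Dec P) (q? : Dec Q) → P → Q → ⌊ p? ⌋ ∧ ⌊ q? ⌋ ≡ true
  both (yes _) (yes _) _ _ = refl
  both (no h)  _       p _ = ⊥-elim (h p)
  both (yes _) (no h)  _ q = ⊥-elim (h q)

  addEdge-present : ∀ {G : Graph n} {es} u v → (∀ {x y} → x ≢ y → (x , y) ∉ (u , v) ∷ es → (y , x) ∉ (u , v) ∷ es → G x y ≡ true) →
    ∀ {x y} → x ≢ y → (x , y) ∉ es → (y , x) ∉ es → addEdge G u v x y ≡ true
  addEdge-present {G} {es} u v full {x} {y} x≢y p q with (x ≟ u) ×-dec (y ≟ v) | (x ≟ v) ×-dec (y ≟ u)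
  ... | yes (eq , eq′) | _ = trans (cong (λ b → G x y ∨ (b ∨ (⌊ x ≟ v ⌋ ∧ ⌊ y ≟ u ⌋))) (both (x ≟ u) (y ≟ v) eq eq′)) (∨-zeroʳ (G x y))
  ... | no _ | yes (eq , eq′) = trans (cong (λ b → G x y ∨ (⌊ x ≟ u ⌋ ∧ ⌊ y ≟ v ⌋ ∨ b)) (both (x ≟ v) (y ≟ u) eq eq′))
    (trans (cong (G x y ∨_) (∨-zeroʳ _)) (∨-zeroʳ (G x y)))
  ... | no same | no reverse = cong (_∨ _) (full x≢y
    (λ { (here refl) → same (refl , refl) ; (there i) → p i }) (λ { (here refl) → reverse (refl , refl) ; (there i) → q i }))

  -- Every missing pair is listed and, apart from the head, avoids the cut; once the head is added,
  -- the two classes are completely joined.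
  peel-valid : ∀ {G : Graph n} {es} → (∀ {x y} → x ≢ y → (x , y) ∉ es → (y , x) ∉ es → G x y ≡ true) →
    Peel {n} {s} es → ValidSequence s s G es
  peel-valid full [] = tt
  peel-valid {G} {(u , v) ∷ es} full (peel c cr av p)
    with cut-copy {addEdge G u v} c (λ {x} {y} a b → addEdge-present {G} u v full (λ { refl → A∩B c a b })
        (λ i → All.lookup av i (inj₁ (a , b))) (λ i → All.lookup av i (inj₂ (b , a))))
  ... | f , copy , through = (f , copy , through cr) , peel-valid (addEdge-present {G} u v full) p

  -- A copy yields a cut that every listed edge avoids, so an edge of the copy could be put in front
  -- of the list, making it longer than `too-dense` permits.
  peel-free : 3 ≤ s → ∀ {G : Graph n} {es} → All (Absent G) es → 4 * s ≤ length es + 4 → Peel {n} {s} es → ¬ ContainsKst s s G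
  peel-free 3≤s@(s≤s _) {G} absent long p (f , copy) with copy-cut {G} copy
  ... | c , classes , avoid = too-dense 3≤s (peel c (inj₁ (classes zero zero)) (All.map avoid absent) p) (s≤s long)

-- Counting edges and non-edges

⌊⌋-true : ∀ {P : Set} (p? : Dec P) → P → ⌊ p? ⌋ ≡ true
⌊⌋-true (yes _) _ = refl
⌊⌋-true (no h)  p = ⊥-elim (h p)

⌊⌋-false : ∀ {P : Set} (p? : Dec P) → ¬ P → ⌊ p? ⌋ ≡ false
⌊⌋-false (yes p) h = ⊥-elim (h p)
⌊⌋-false (no _)  _ = refl

pairs : ∀ {n} → (Fin n → Fin n → ℕ) → ℕ
pairs {n} F = total (allFin n) (λ i → total (allFin n) (F i))

pairs-cong : ∀ {n} {F F′ : Fin n → Fin n → ℕ} → (∀ i j → F i j ≡ F′ i j) → pairs F ≡ pairs F′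
pairs-cong {n} eq = total-cong (allFin n) (λ i → total-cong (allFin n) (eq i))

pairs-+ : ∀ {n} (F F′ : Fin n → Fin n → ℕ) → pairs (λ i j → F i j + F′ i j) ≡ pairs F + pairs F′
pairs-+ {n} F F′ = trans (total-cong (allFin n) (λ i → total-+ (F i) (F′ i) (allFin n)))
  (total-+ (λ i → total (allFin n) (F i)) (λ i → total (allFin n) (F′ i)) (allFin n))

pairs-total : ∀ {n} (F : S → Fin n → Fin n → ℕ) xs →
  pairs (λ i j → total xs (λ x → F x i j)) ≡ total xs (λ x → pairs (F x))
pairs-total {n = n} F xs = trans
  (total-cong (allFin n) (λ i → total-swap (λ j x → F x i j) (allFin n) xs))
  (total-swap (λ i x → total (allFin n) (F x i)) (allFin n) xs)

-- Pascal's rule: `n C 1` pairs start at the vertex 0, and the others are pairs of the remaining n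
-- vertices.
ordered-pairs : ∀ n → pairs {n} (λ i j → bit ⌊ toℕ i <? toℕ j ⌋) ≡ n C 2
ordered-pairs zero    = refl
ordered-pairs (suc n) = trans (total-allFin {n} (λ i → total (allFin (suc n)) (λ j → bit ⌊ toℕ i <? toℕ j ⌋)))
  (trans (cong₂ _+_ first others) (nCk+nC[k+1]≡[n+1]C[k+1] n 1))
  where
  shift : ∀ a b → ⌊ suc a <? suc b ⌋ ≡ ⌊ a <? b ⌋
  shift a b with a <? b
  ... | yes p = ⌊⌋-true (suc a <? suc b) (s≤s p)
  ... | no h  = ⌊⌋-false (suc a <? suc b) (h ∘ ≤-pred)
  first : total (allFin (suc n)) (λ j → bit ⌊ 0 <? toℕ j ⌋) ≡ n C 1
  first = trans (total-allFin {n} (λ j → bit ⌊ 0 <? toℕ j ⌋))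
    (trans (trans (total-one (allFin n)) (length-tabulate id)) (sym (nC1≡n n)))
  others : total (allFin n) (λ i → total (allFin (suc n)) (λ j → bit ⌊ suc (toℕ i) <? toℕ j ⌋)) ≡ n C 2
  others = trans (total-cong (allFin n) (λ i → total-allFin {n} (λ j → bit ⌊ suc (toℕ i) <? toℕ j ⌋)))
    (trans (pairs-cong {n} {λ i j → bit ⌊ suc (toℕ i) <? suc (toℕ j) ⌋} λ i j → cong bit (shift (toℕ i) (toℕ j))) (ordered-pairs n))

indicator : ∀ {n} → Edge n → Fin n → Fin n → ℕ
indicator (u , v) i j = bit (⁅ u ⁆ i ∧ ⁅ v ⁆ j)

pairs-indicator : ∀ {n} (e : Edge n) → pairs (indicator e) ≡ 1
pairs-indicator {n} (u , v) = trans (total-cong (allFin n) row) (trans (sym (card-total ⁅ u ⁆)) (card-⁅⁆ u))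
  where
  row : ∀ i → total (allFin n) (indicator (u , v) i) ≡ bit (⁅ u ⁆ i)
  row i with ⁅ u ⁆ i
  ... | true  = trans (sym (card-total ⁅ v ⁆)) (card-⁅⁆ v)
  ... | false = total-zero (allFin n) (λ _ → refl)

indicator-≡ : ∀ {n} (i j : Fin n) → indicator (i , j) i j ≡ 1
indicator-≡ i j = cong bit (trans (cong (_∧ ⁅ j ⁆ j) (holds ∈⁅⁆)) (holds ∈⁅⁆))

indicator-≢ : ∀ {n} {e : Edge n} {i j} → e ≢ (i , j) → indicator e i j ≡ 0
indicator-≢ {e = u , v} {i} {j} neq with i ∈? ⁅ u ⁆ | j ∈? ⁅ v ⁆
... | yes p | yes q = ⊥-elim (neq (cong₂ _,_ (sym (∈⁅⁆⁻ p)) (sym (∈⁅⁆⁻ q))))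
... | yes p | no q  = cong bit (trans (cong (_∧ ⁅ v ⁆ j) (holds p)) (∉-false q))
... | no p  | _     = cong bit (cong (_∧ ⁅ v ⁆ j) (∉-false p))

indicator-∉ : ∀ {n} {es : List (Edge n)} {i j} → (i , j) ∉ es → total es (λ e → indicator e i j) ≡ 0
indicator-∉ {es = []}     _ = refl
indicator-∉ {es = e ∷ es} p = cong₂ _+_ (indicator-≢ (λ { refl → p (here refl) })) (indicator-∉ (p ∘ there))

indicator-∈ : ∀ {n} {es : List (Edge n)} {i j} → Unique es → (i , j) ∈ es → total es (λ e → indicator e i j) ≡ 1
indicator-∈ (fresh ∷ᴾ _) (here refl) = cong₂ _+_ (indicator-≡ _ _) (indicator-∉ (λ p → All.lookup fresh p refl))
indicator-∈ (fresh ∷ᴾ uniq) (there p) = cong₂ _+_ (indicator-≢ (λ { refl → All.lookup fresh p refl })) (indicator-∈ uniq p)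

-- Double counting of the increasing pairs: each is either an edge or listed, and by uniqueness
-- listed only once.
edgeCount-ordering : ∀ {n} {G : Graph n} {es} → IsNonEdgeOrdering G es → edgeCount G + length es ≡ n C 2
edgeCount-ordering {n} {G} {es} (uniq , sound , complete) = trans (cong (edgeCount G +_) (sym count))
  (trans (sym (pairs-+ (λ i j → bit (⌊ toℕ i <? toℕ j ⌋ ∧ G i j)) (λ i j → total es (λ e → indicator e i j))))
    (trans (pairs-cong dichotomy) (ordered-pairs n)))
  where
  count : pairs (λ i j → total es (λ e → indicator e i j)) ≡ length es
  count = trans (pairs-total indicator es) (trans (total-cong es pairs-indicator) (total-one es))
  dichotomy : ∀ i j → bit (⌊ toℕ i <? toℕ j ⌋ ∧ G i j) + total es (λ e → indicator e i j) ≡ bit ⌊ toℕ i <? toℕ j ⌋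
  dichotomy i j with toℕ i <? toℕ j | G i j in eq
  ... | yes i<j | false = indicator-∈ uniq (complete i j i<j eq)
  ... | yes i<j | true  = cong suc (indicator-∉ (λ p → conflict eq (proj₂ (sound i j p))))
  ... | no i≮j  | _     = indicator-∉ (λ p → i≮j (proj₁ (sound i j p)))

-- The graph with prescribed non-edges

module _ {n : ℕ} (es : List (Edge n)) where

  Joined : Fin n → Fin n → Set
  Joined i j = i ≢ j × (i , j) ∉ es × (j , i) ∉ es

  listed? : ∀ i j → Dec ((i , j) ∈ es)
  listed? i j = member? (≡-dec _≟_ _≟_) (i , j) es

  joined? : ∀ i j → Dec (Joined i j)
  joined? i j = ¬? (i ≟ j) ×-dec ¬? (listed? i j) ×-dec ¬? (listed? j i)

  complement : Graph n
  complement i j = ⌊ joined? i j ⌋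

  complement-simple : IsSimple complement
  complement-simple = (λ i → ⌊⌋-false (joined? i i) (λ (h , _) → h refl)) , symmetric
    where
    symmetric : ∀ i j → complement i j ≡ complement j i
    symmetric i j with joined? i j
    ... | yes (h , p , q) = sym (⌊⌋-true (joined? j i) (h ∘ sym , q , p))
    ... | no h            = sym (⌊⌋-false (joined? j i) (λ (g , p , q) → h (g ∘ sym , q , p)))

  complement-absent : ∀ {e} → e ∈ es → complement (proj₁ e) (proj₂ e) ≡ false × complement (proj₂ e) (proj₁ e) ≡ false
  complement-absent {i , j} p = ⌊⌋-false (joined? i j) (λ (_ , q , _) → q p) , ⌊⌋-false (joined? j i) (λ (_ , _ , q) → q p)

  complement-ordering : Unique es → (∀ {i j} → (i , j) ∈ es → toℕ i < toℕ j) → IsNonEdgeOrdering complement es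
  complement-ordering uniq ordered = uniq , (λ i j p → ordered p , proj₁ (complement-absent p)) , found
    where
    found : ∀ i j → toℕ i < toℕ j → complement i j ≡ false → (i , j) ∈ es
    found i j i<j g = decidable-stable (listed? i j) λ p → conflict (⌊⌋-true (joined? i j)
      ((λ { refl → <-irrefl refl i<j }) , p , (λ q → <-asym i<j (ordered q)))) g

-- An edge crosses its own cut and all later edges avoid it, so none of them repeats it.
peel-unique : ∀ {n s} {es : List (Edge n)} → Peel {n} {s} es → Unique es
peel-unique []                = []ᴾ
peel-unique (peel c cr av p) = All.map (λ { a refl → a cr }) av ∷ᴾ peel-unique p

-- Books

-- Triangles on a common spine `p q`, in the order of removal: the pages, the spine, then `es`. With
-- m pages there are 2m + 1 edges on m + 2 vertices, the most that sparsity allows.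
book : ∀ {n} → Fin n → Fin n → List (Fin n) → List (Edge n) → List (Edge n)
book p q []       es = (p , q) ∷ es
book p q (x ∷ xs) es = (q , x) ∷ (p , x) ∷ book p q xs es

book-length : ∀ {n} (p q : Fin n) xs es → length (book p q xs es) ≡ suc (2 * length xs + length es)
book-length p q []       es = refl
book-length p q (x ∷ xs) es = trans (cong (λ m → suc (suc m)) (book-length p q xs es))
  (cong (λ m → suc (m + length es)) (sym (*-suc 2 (length xs))))

book-All : ∀ {n} {P : Edge n → Set} {p q xs es} → P (p , q) → All (λ x → P (q , x) × P (p , x)) xs → All P es →
  All P (book p q xs es)
book-All pq []ᴬ              h = pq ∷ᴬ h
book-All pq ((a , b) ∷ᴬ abs) h = a ∷ᴬ b ∷ᴬ book-All pq abs h

module _ {n s : ℕ} (n≡ : n ≡ 2 * s + 1) {D : VSet n} (sD : suc (card D) ≡ s) where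

  Outside : VSet n → Edge n → Set
  Outside X (x , y) = x ∉ˢ X × y ∉ˢ X

  module _ {x o : Fin n} (x∉D : x ∉ˢ D) (o∉D : o ∉ˢ D) (o≢x : o ≢ x) where

    class : VSet n
    class = D ∪ ⁅ x ⁆

    o∉class : o ∉ˢ class
    o∉class p = [ o∉D , (λ q → o≢x (∈⁅⁆⁻ q)) ]′ (∈∪⁻ p)

    -- `D` lacks one vertex to be a class, and `x` supplies it. When `x` has two neighbours left,
    -- both outside `D`, making one of them the centre leaves only the edge to the other crossing.
    pendant-cut : Cut n s
    pendant-cut = class-cut n≡ o∉class (trans (card-insert x∉D) sD)

    pendant-crosses : ∀ {y z} → y ∉ˢ class → y ≢ o → z ∈ˢ class → Crosses pendant-cut (y , z)
    pendant-crosses y∉ y≢o z∈ = inj₂ (∈∁ (λ p → [ y∉ , (λ q → y≢o (∈⁅⁆⁻ q)) ]′ (∈∪⁻ p)) , z∈)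

    avoids-outside : ∀ {e} → Within D e ⊎ Outside class e → Avoids pendant-cut e
    avoids-outside (inj₁ (i , j)) (inj₁ (a , b)) = ∈∁⁻ b (∈∪ˡ (∈∪ˡ j))
    avoids-outside (inj₁ (i , j)) (inj₂ (b , a)) = ∈∁⁻ b (∈∪ˡ (∈∪ˡ i))
    avoids-outside (inj₂ (i , j)) (inj₁ (a , b)) = i a
    avoids-outside (inj₂ (i , j)) (inj₂ (b , a)) = j a

    avoids-centre : ∀ {y} → Avoids pendant-cut (o , y)
    avoids-centre (inj₁ (a , _)) = o∉class a
    avoids-centre (inj₂ (b , _)) = ∈∁⁻ b (∈∪ʳ ∈⁅⁆)

  record Page (p q x : Fin n) : Set where
    constructor page
    field
      x∉D : x ∉ˢ D
      x≢p : x ≢ p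
      x≢q : x ≢ q

  book-avoids : ∀ {x p q xs es} → p ∉ˢ D → q ∉ˢ D → x ≢ p → x ≢ q → All (x ≢_) xs → All (Page p q) xs → All (Within D) es →
    All (λ e → Within D e ⊎ Outside (D ∪ ⁅ x ⁆) e) (book p q xs es)
  book-avoids {x} {p} {q} p∉D q∉D x≢p x≢q fresh pages inD =
    book-All (inj₂ (off p∉D x≢p , off q∉D x≢q))
      (All.zipWith (λ (x≢y , pg) → inj₂ (off q∉D x≢q , off (Page.x∉D pg) x≢y) , inj₂ (off p∉D x≢p , off (Page.x∉D pg) x≢y)) (fresh , pages))
      (All.map inj₁ inD)
    where
    off : ∀ {y} → y ∉ˢ D → x ≢ y → y ∉ˢ D ∪ ⁅ x ⁆
    off y∉D x≢y h = [ y∉D , (λ i → x≢y (sym (∈⁅⁆⁻ i))) ]′ (∈∪⁻ h)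

  -- A page `x` has two edges: with centre `p` only the one to `q` crosses, and then with centre `q`
  -- the one to `p`. For the spine, `p` plays the role of `x` and a third vertex `o` is the centre.
  -- The edges of `es` stay inside `D`, hence inside a class, throughout.
  book-peel : ∀ {p q o xs es} → p ∉ˢ D → q ∉ˢ D → o ∉ˢ D → p ≢ q → o ≢ p → o ≢ q → Unique xs → All (Page p q) xs →
    All (Within D) es → Peel {n} {s} es → Peel {n} {s} (book p q xs es)
  book-peel {p} {q} {o} p∉D q∉D o∉D p≢q o≢p o≢q []ᴾ []ᴬ inD es =
    peel (pendant-cut p∉D o∉D o≢p)
      (⊎-swap-edge {c = pendant-cut p∉D o∉D o≢p} (pendant-crosses p∉D o∉D o≢p (λ h → [ q∉D , (λ i → p≢q (sym (∈⁅⁆⁻ i))) ]′ (∈∪⁻ h)) (o≢q ∘ sym) (∈∪ʳ ∈⁅⁆)))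
      (All.map (λ w → avoids-outside p∉D o∉D o≢p (inj₁ w)) inD) es
    where
    ⊎-swap-edge : ∀ {c : Cut n s} {x y} → Crosses c (x , y) → Crosses c (y , x)
    ⊎-swap-edge (inj₁ (a , b)) = inj₂ (b , a)
    ⊎-swap-edge (inj₂ (b , a)) = inj₁ (a , b)
  book-peel {p} {q} {xs = x ∷ xs} {es} p∉D q∉D o∉D p≢q o≢p o≢q (fresh ∷ᴾ uniq) (page x∉D x≢p x≢q ∷ᴬ pages) inD es-peel =
    peel (pendant-cut x∉D p∉D (x≢p ∘ sym))
      (pendant-crosses x∉D p∉D (x≢p ∘ sym) (off q∉D x≢q) (p≢q ∘ sym) (∈∪ʳ ∈⁅⁆))
      (avoids-centre x∉D p∉D (x≢p ∘ sym) ∷ᴬ All.map (avoids-outside x∉D p∉D (x≢p ∘ sym)) rest)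
      (peel (pendant-cut x∉D q∉D (x≢q ∘ sym))
        (pendant-crosses x∉D q∉D (x≢q ∘ sym) (off p∉D x≢p) p≢q (∈∪ʳ ∈⁅⁆))
        (All.map (avoids-outside x∉D q∉D (x≢q ∘ sym)) rest)
        (book-peel p∉D q∉D o∉D p≢q o≢p o≢q uniq pages inD es-peel))
    where
    off : ∀ {y} → y ∉ˢ D → x ≢ y → y ∉ˢ D ∪ ⁅ x ⁆
    off y∉D x≢y h = [ y∉D , (λ i → x≢y (sym (∈⁅⁆⁻ i))) ]′ (∈∪⁻ h)
    rest : All (λ e → Within D e ⊎ Outside (D ∪ ⁅ x ⁆) e) (book p q xs es)
    rest = book-avoids p∉D q∉D x≢p x≢q fresh pages inD

-- The extremal edge list

opaque

  interval : ∀ {n} → ℕ → ℕ → VSet n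
  interval a b x = ⌊ (a ≤? toℕ x) ×-dec (toℕ x <? b) ⌋

  ∈interval : ∀ {n a b} {x : Fin n} → a ≤ toℕ x → toℕ x < b → x ∈ˢ interval a b
  ∈interval {a = a} {b} {x} p q = member (⌊⌋-true ((a ≤? toℕ x) ×-dec (toℕ x <? b)) (p , q))

  ∈interval⁻ : ∀ {n a b} {x : Fin n} → x ∈ˢ interval a b → a ≤ toℕ x × toℕ x < b
  ∈interval⁻ {a = a} {b} {x} (member h) = decidable-stable ((a ≤? toℕ x) ×-dec (toℕ x <? b))
    (λ p → conflict h (⌊⌋-false ((a ≤? toℕ x) ×-dec (toℕ x <? b)) p))

card-interval : ∀ {n} a k → a + k ≤ n → card {n} (interval a (a + k)) ≡ k
card-interval {n} zero zero h = card-empty (λ {x} p → absurd (≤-trans (s≤s z≤n) (proj₂ (∈interval⁻ {x = x} p))))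
card-interval {suc n} zero (suc k) (s≤s h) = trans (card-suc (interval 0 (suc k)))
  (cong₂ _+_ (cong bit (holds (∈interval {a = 0} {suc k} {zero} z≤n (s≤s z≤n))))
    (trans (card-≡ {Y = interval 0 k} (λ p → ∈interval z≤n (≤-pred (proj₂ (∈interval⁻ (member (holds p))))))
      (λ p → member (holds (∈interval {a = 0} {suc k} z≤n (s≤s (proj₂ (∈interval⁻ p))))))) (card-interval 0 k h)))
card-interval {suc n} (suc a) k (s≤s h) = trans (card-suc (interval (suc a) (suc (a + k))))
  (cong₂ _+_ (cong bit (∉-false {X = interval (suc a) (suc (a + k))} (λ p → absurd (≤-trans (s≤s z≤n) (proj₁ (∈interval⁻ {x = zero} p))))))
    (trans (card-≡ {Y = interval a (a + k)}
      (λ p → ∈interval (≤-pred (proj₁ (∈interval⁻ (member (holds p))))) (≤-pred (proj₂ (∈interval⁻ (member (holds p))))))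
      (λ p → member (holds (∈interval (s≤s (proj₁ (∈interval⁻ p))) (s≤s (proj₂ (∈interval⁻ p)))))))
      (card-interval a k h)))

listing : ∀ {n} k (X : VSet n) → card X ≡ k → ∃ λ xs → Unique xs × length xs ≡ k × All (_∈ˢ X) xs
listing k X c with enumerate k X c
... | g , inj , into , _ = tabulate g , Unique.tabulate⁺ inj , length-tabulate g , tabulate⁺ into

vertex : ∀ {n} k → k < n → ∃ λ (x : Fin n) → toℕ x ≡ k
vertex k k<n = fromℕ< k<n , toℕ-fromℕ< k<n

module Extremal {n s t : ℕ} (s≡ : s ≡ 3 + t) (n≡ : n ≡ 2 * s + 1) where

  halves : suc s + (2 + t) ≡ 2 * s
  halves = trans (cong (λ m → 1 + m + (2 + t)) s≡) (trans (eq t) (cong (2 *_) (sym s≡)))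
    where
    eq : ∀ t → 1 + (3 + t) + (2 + t) ≡ 2 * (3 + t)
    eq t = solve (t ∷ [])

  3≤s : 3 ≤ s
  3≤s = ≤-trans (m≤m+n 3 t) (≤-reflexive (sym s≡))

  2s<n : 2 * s < n
  2s<n = ≤-reflexive (trans (+-comm 1 (2 * s)) (sym n≡))

  at : ∀ k → k ≤ 2 * s → Fin n
  at k h = fromℕ< (≤-trans (s≤s h) 2s<n)

  toℕ-at : ∀ {k} (h : k ≤ 2 * s) → toℕ (at k h) ≡ k
  toℕ-at h = toℕ-fromℕ< _

  at-≢ : ∀ {i j} (p : i ≤ 2 * s) (q : j ≤ 2 * s) → i ≢ j → at i p ≢ at j q
  at-≢ p q neq eq = neq (trans (sym (toℕ-at p)) (trans (cong toℕ eq) (toℕ-at q)))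

  at-< : ∀ {i} {x : Fin n} (p : i ≤ 2 * s) → i < toℕ x → toℕ (at i p) < toℕ x
  at-< p h = ≤-trans (s≤s (≤-reflexive (toℕ-at p))) h

  at∉ : ∀ {k a b} (h : k ≤ 2 * s) → k < a ⊎ b ≤ k → at k h ∉ˢ interval a b
  at∉ h (inj₁ p) i = <-irrefl refl (≤-trans p (subst (_ ≤_) (toℕ-at h) (proj₁ (∈interval⁻ i))))
  at∉ h (inj₂ p) i = <-irrefl refl (≤-trans (subst (_< _) (toℕ-at h) (proj₂ (∈interval⁻ i))) p)

  at∈ : ∀ {k a b} (h : k ≤ 2 * s) → a ≤ k → k < b → at k h ∈ˢ interval a b
  at∈ h p q = ∈interval (subst (_ ≤_) (sym (toℕ-at h)) p) (subst (_< _) (sym (toℕ-at h)) q)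

  ∈-≢ : ∀ {k a b x} (h : k ≤ 2 * s) → k < a ⊎ b ≤ k → x ∈ˢ interval a b → x ≢ at k h
  ∈-≢ h p i refl = at∉ h p i

  -- The vertices run through `a₀`, `a₁`, `left`, `right`, `y`, where `right` consists of `b₀`, `b₁`
  -- and `inner`. The books have pages `left` and `inner`. As `left` and `right` have s - 1 vertices
  -- each, either one serves as `D` for the book on the other side.
  left right inner : VSet n
  left  = interval 2 (suc s)
  right = interval (suc s) (suc s + (2 + t))
  inner = interval (3 + s) (3 + s + t)

  1+s≤ : suc s ≤ 2 * s
  1+s≤ = ≤-trans (m≤m+n (suc s) (2 + t)) (≤-reflexive halves)

  2+s≤ : 2 + s ≤ 2 * s
  2+s≤ = ≤-trans (≤-trans (≤-reflexive (+-comm 1 (suc s))) (≤-refl {suc s} ⊕ s≤s z≤n)) (≤-reflexive halves)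

  1≤2s : 1 ≤ 2 * s
  1≤2s = ≤-trans (s≤s z≤n) 1+s≤

  3+s+t≡ : 3 + s + t ≡ suc s + (2 + t)
  3+s+t≡ = cong suc (sym (trans (+-suc s (suc t)) (cong suc (+-suc s t))))

  a₀ a₁ b₀ b₁ y : Fin n
  a₀ = at 0 z≤n
  a₁ = at 1 1≤2s
  b₀ = at (suc s) 1+s≤
  b₁ = at (2 + s) 2+s≤
  y  = at (2 * s) ≤-refl

  left-card : suc (card left) ≡ s
  left-card = trans (cong suc (trans (cong (λ m → card {n} (interval 2 m)) (cong suc s≡))
    (card-interval 2 (2 + t) (≤-trans (≤-reflexive (cong suc (sym s≡))) (≤-trans 1+s≤ (≤-trans (n≤1+n _) 2s<n)))))) (sym s≡)

  right-card : suc (card right) ≡ s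
  right-card = trans (cong suc (card-interval (suc s) (2 + t) (≤-trans (≤-reflexive halves) (≤-trans (n≤1+n _) 2s<n)))) (sym s≡)

  inner-card : card inner ≡ t
  inner-card = card-interval (3 + s) t (≤-trans (≤-reflexive (trans 3+s+t≡ halves)) (≤-trans (n≤1+n _) 2s<n))

  lefts : ∃ λ xs → Unique xs × length xs ≡ 2 + t × All (_∈ˢ left) xs
  lefts = listing (2 + t) left (+-cancelˡ-≡ 1 _ _ (trans left-card s≡))

  inners : ∃ λ xs → Unique xs × length xs ≡ t × All (_∈ˢ inner) xs
  inners = listing t inner inner-card

  -- The books have 2(s - 1) + 1 and 2(s - 3) + 1 edges; with the two links this makes 4s - 4.
  right-book whole-book edges : List (Edge n)
  right-book = book b₀ b₁ (proj₁ inners) []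
  whole-book = book a₀ a₁ (proj₁ lefts) right-book
  edges      = (a₁ , b₀) ∷ (a₀ , y) ∷ whole-book

  a₀≢a₁ : a₀ ≢ a₁
  a₀≢a₁ = at-≢ z≤n 1≤2s λ ()
  b₀≢b₁ : b₀ ≢ b₁
  b₀≢b₁ = at-≢ 1+s≤ 2+s≤ λ eq → <-irrefl eq ≤-refl
  a₀∉right : a₀ ∉ˢ right
  a₀∉right = at∉ z≤n (inj₁ (s≤s z≤n))
  a₁∉right : a₁ ∉ˢ right
  a₁∉right = at∉ 1≤2s (inj₁ (s≤s (≤-trans (s≤s z≤n) 3≤s)))
  y∉right : y ∉ˢ right
  y∉right = at∉ ≤-refl (inj₂ (≤-reflexive halves))
  y≢a₀ : y ≢ a₀
  y≢a₀ = at-≢ ≤-refl z≤n λ eq → <⇒≢ 1≤2s (sym eq)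
  y≢a₁ : y ≢ a₁
  y≢a₁ = at-≢ ≤-refl 1≤2s λ eq → <⇒≢ (≤-trans (s≤s (≤-trans (s≤s z≤n) 3≤s)) 1+s≤) (sym eq)
  b₀∈right : b₀ ∈ˢ right
  b₀∈right = at∈ 1+s≤ ≤-refl (≤-trans 2+s≤ (≤-reflexive (sym halves)))
  b₁∈right : b₁ ∈ˢ right
  b₁∈right = at∈ 2+s≤ (n≤1+n _) (≤-trans (s≤s (m≤m+n (2 + s) t)) (≤-reflexive 3+s+t≡))

  left∉right : ∀ {x} → x ∈ˢ left → x ∉ˢ right
  left∉right i j = <-irrefl refl (≤-trans (proj₂ (∈interval⁻ i)) (proj₁ (∈interval⁻ j)))

  inner⊆right : inner ⊆ right
  inner⊆right i = ∈interval (≤-trans (≤-trans (n≤1+n _) (n≤1+n _)) (proj₁ (∈interval⁻ i)))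
    (≤-trans (proj₂ (∈interval⁻ i)) (≤-reflexive 3+s+t≡))

  outside-left : ∀ {k} (h : k ≤ 2 * s) → suc s ≤ k → at k h ∉ˢ left
  outside-left h p = at∉ h (inj₂ p)

  right-peel : Peel {n} {s} right-book
  right-peel = book-peel n≡ left-card {o = y} (outside-left 1+s≤ ≤-refl) (outside-left 2+s≤ (n≤1+n _)) (outside-left ≤-refl 1+s≤)
    b₀≢b₁ (λ eq → y∉right (subst (_∈ˢ right) (sym eq) b₀∈right)) (λ eq → y∉right (subst (_∈ˢ right) (sym eq) b₁∈right))
    (proj₁ (proj₂ inners))
    (All.map (λ i → page (λ j → left∉right j (inner⊆right i)) (∈-≢ 1+s≤ (inj₁ (n≤1+n _)) i) (∈-≢ 2+s≤ (inj₁ ≤-refl) i))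
      (proj₂ (proj₂ (proj₂ inners))))
    []ᴬ []

  right-within : All (Within right) right-book
  right-within = book-All (b₀∈right , b₁∈right)
    (All.map (λ i → (b₁∈right , inner⊆right i) , (b₀∈right , inner⊆right i)) (proj₂ (proj₂ (proj₂ inners)))) []ᴬ

  left-pages : All (Page n≡ right-card a₀ a₁) (proj₁ lefts)
  left-pages = All.map (λ i → page (left∉right i) (∈-≢ z≤n (inj₁ (s≤s z≤n)) i) (∈-≢ 1≤2s (inj₁ ≤-refl) i)) (proj₂ (proj₂ (proj₂ lefts)))

  whole-peel : Peel {n} {s} whole-book
  whole-peel = book-peel n≡ right-card {o = y} a₀∉right a₁∉right y∉right a₀≢a₁ y≢a₀ y≢a₁
    (proj₁ (proj₂ lefts)) left-pages right-within right-peel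

  whole-outside : All (λ e → Within right e ⊎ Outside n≡ right-card (right ∪ ⁅ y ⁆) e) whole-book
  whole-outside = book-avoids n≡ right-card a₀∉right a₁∉right y≢a₀ y≢a₁
    (All.map (λ i → ∈-≢ ≤-refl (inj₂ 1+s≤) i ∘ sym) (proj₂ (proj₂ (proj₂ lefts)))) left-pages right-within

  off : ∀ {x} → x ∉ˢ right → y ≢ x → x ∉ˢ right ∪ ⁅ y ⁆
  off x∉ y≢x h = [ x∉ , (λ i → y≢x (sym (∈⁅⁆⁻ i))) ]′ (∈∪⁻ h)

  -- Both links use the class `right` with `y` added: centred at `a₀` its cut is crossed only by the
  -- link from `a₁` to `b₀`, and then centred at `a₁` only by the link from `a₀` to `y`.
  edges-peel : Peel {n} {s} edges
  edges-peel =
    peel (cut a₀∉right y≢a₀)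
      (pendant-crosses n≡ right-card y∉right a₀∉right (y≢a₀ ∘ sym) (off a₁∉right y≢a₁) (a₀≢a₁ ∘ sym) (∈∪ˡ b₀∈right))
      (avoids-centre n≡ right-card y∉right a₀∉right (y≢a₀ ∘ sym) ∷ᴬ
        All.map (avoids-outside n≡ right-card y∉right a₀∉right (y≢a₀ ∘ sym)) whole-outside)
      (peel (cut a₁∉right y≢a₁)
        (pendant-crosses n≡ right-card y∉right a₁∉right (y≢a₁ ∘ sym) (off a₀∉right y≢a₀) a₀≢a₁ (∈∪ʳ ∈⁅⁆))
        (All.map (avoids-outside n≡ right-card y∉right a₁∉right (y≢a₁ ∘ sym)) whole-outside)
        whole-peel)
    where
    cut : ∀ {o} → o ∉ˢ right → y ≢ o → Cut n s
    cut o∉ y≢o = pendant-cut n≡ right-card y∉right o∉ (y≢o ∘ sym)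

  edges-length : length edges + 4 ≡ 4 * s
  edges-length = trans (cong (λ m → 2 + m + 4) (book-length a₀ a₁ (proj₁ lefts) right-book))
    (trans (trans (cong₂ (λ i j → 2 + suc (2 * i + j) + 4) (proj₁ (proj₂ (proj₂ lefts)))
      (trans (book-length b₀ b₁ (proj₁ inners) []) (cong (λ m → suc (2 * m + 0)) (proj₁ (proj₂ (proj₂ inners))))))
      (eq t)) (cong (4 *_) (sym s≡)))
    where
    eq : ∀ t → 2 + (1 + (2 * (2 + t) + (1 + (2 * t + 0)))) + 4 ≡ 4 * (3 + t)
    eq t = solve (t ∷ [])

  edges-ordered : All (λ e → toℕ (proj₁ e) < toℕ (proj₂ e)) edges
  edges-ordered = at-< 1≤2s (subst (1 <_) (sym (toℕ-at 1+s≤)) (s≤s (≤-trans (s≤s z≤n) 3≤s)))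
    ∷ᴬ at-< z≤n (subst (0 <_) (sym (toℕ-at ≤-refl)) (≤-trans (s≤s z≤n) 1+s≤))
    ∷ᴬ book-All (at-< z≤n (subst (0 <_) (sym (toℕ-at 1≤2s)) ≤-refl))
      (All.map (λ i → at-< 1≤2s (proj₁ (∈interval⁻ i)) , at-< z≤n (≤-trans (s≤s z≤n) (proj₁ (∈interval⁻ i)))) (proj₂ (proj₂ (proj₂ lefts))))
      (book-All (at-< 1+s≤ (subst (suc s <_) (sym (toℕ-at 2+s≤)) ≤-refl))
        (All.map (λ i → at-< 2+s≤ (proj₁ (∈interval⁻ i)) , at-< 1+s≤ (≤-trans (n≤1+n _) (proj₁ (∈interval⁻ i)))) (proj₂ (proj₂ (proj₂ inners))))
        []ᴬ)

-- Both bounds, turned from non-edges to edges.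

theorem1 : ∀ (s : ℕ) → 3 ≤ s →
    WsatIs (2 * s + 1) s s (((2 * s + 1) C 2) ∸ (4 * s ∸ 4))
theorem1 s 3≤s = attained , minimal
  where
  minimal : ∀ (G : Graph (2 * s + 1)) → IsSimple G → WeaklySat s s G → ((2 * s + 1) C 2) ∸ (4 * s ∸ 4) ≤ edgeCount G
  minimal G (_ , symmetric) (_ , es , ordering@(uniq , sound , _) , valid) = ≤-trans
    (∸-monoʳ-≤ ((2 * s + 1) C 2) (m+n≤o⇒m≤o∸n (length es) (peel-length 3≤s p)))
    (≤-reflexive (trans (cong (_∸ length es) (sym (edgeCount-ordering ordering))) (m+n∸n≡m (edgeCount G) (length es))))
    where
    p : Peel {2 * s + 1} {s} es
    p = valid-peel refl uniq (All.tabulate (λ {e} i → proj₁ (sound (proj₁ e) (proj₂ e) i)))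
      (All.tabulate (λ {e} i → let g = proj₂ (sound (proj₁ e) (proj₂ e) i) in g , trans (symmetric (proj₂ e) (proj₁ e)) g)) valid
  open Extremal {s = s} {s ∸ 3} (sym (m+[n∸m]≡n 3≤s)) refl using (edges; edges-peel; edges-length; edges-ordered)
  ordering : IsNonEdgeOrdering (complement edges) edges
  ordering = complement-ordering edges (peel-unique edges-peel) (All.lookup edges-ordered)
  attained : ∃ λ (G : Graph (2 * s + 1)) → IsSimple G × WeaklySat s s G × edgeCount G ≡ ((2 * s + 1) C 2) ∸ (4 * s ∸ 4)
  attained = complement edges , complement-simple edges ,
    (peel-free refl 3≤s (All.tabulate (complement-absent edges)) (≤-reflexive (sym edges-length)) edges-peel ,
     edges , ordering , peel-valid refl (λ x≢y p q → ⌊⌋-true (joined? edges _ _) (x≢y , p , q)) edges-peel) ,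
    trans (sym (m+n∸n≡m (edgeCount (complement edges)) (length edges)))
      (cong₂ _∸_ (edgeCount-ordering ordering) (trans (sym (m+n∸n≡m (length edges) 4)) (cong (_∸ 4) edges-length)))
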